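{- Let $q$ be an odd prime power, $d\ge 3$, $E\subset \mathbb F_q^d$ nonempty, $\lambda \in \{1,-1\}$, and $0<N<q$ a real number. Then $$|\mathcal{T}_1(X_\pi, E, N)| \le \begin{cases} \dfrac{Nq^{d-1}}{(q-N)|E|} + \dfrac{Nq^{\frac{d}{2}}}{q-N} ,& \text{if } d \ge 4 \text{ is even},\\[8pt] \dfrac{Nq^{d-1}}{(q-N)|E|} + \dfrac{Nq^{\frac{d-1}{2}}}{q-N} ,& \text{if } d \equiv 3 \pmod{4} \text{ and } q\equiv 3 \pmod 4,\\[8pt] \dfrac{Nq^{d-1}}{(q-N)|E|} + \dfrac{Nq^{\frac{d+1}{2}}}{q-N} , & \text{otherwise}. \end{cases}$$
   Context: $\mathbb F_q$ is the finite field with $q$ elements. For $\mathbf x\in\mathbb F_q^d$, $\|\mathbf x\|=x_1^2+\cdots+x_d^2$, and $\mathbf x\cdot\mathbf y=\sum_i x_iy_i$. $S^{d-1}=\{\mathbf x\in\mathbb F_q^d:\|\mathbf x\|=1\}$, $\pi=\{\mathbf x\in\mathbb F_q^d: x_d=\lambda\}$. $X_\pi$ is the set of lines through the origin (one-dimensional linear subspaces of $\mathbb F_q^d$) that contain a nonzero element of $\pi\cap S^{d-1}$. For a linear subspace $V$, $V^\perp=\{\mathbf x\in\mathbb F_q^d:\mathbf x\cdot\mathbf y=0\ \forall \mathbf y\in V\}$, and $\pi_V(E)=\{\mathbf x+V^\perp:\mathbf x\in\mathbb F_q^d,\ (\mathbf x+V^\perp)\cap E\neq\emptyset\}$, a set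 of cosets. $\mathcal T_1(X_\pi,E,N)=\{V\in X_\pi: |\pi_V(E)|\le N\}$. -}

module Defs where

open import Level using (Level; _⊔_) renaming (suc to lsuc)
open import Algebra.Apartness.Bundles using (HeytingCommutativeRing; HeytingField)
open import Algebra.Bundles using (CommutativeRing)
import Algebra.Definitions.RawMonoid as RawMonoidDefs
import Algebra.Properties.Ring as RingProperties
open import Data.Fin.Base using (Fin; toℕ)
open import Data.Nat.Base as ℕ using (ℕ; zero; suc)
open import Data.Nat.Divisibility using (_∣_)
open import Data.Nat.Primality using (Prime)
open import Data.Product.Base using (_×_; _,_; proj₁; ∃-syntax; ∃₂)
open import Data.Sum.Base using (_⊎_; inj₁; inj₂)
open import Data.Vec.Functional using (Vector)
import Data.Vec.Functional.Relation.Binary.Equality.Setoid as VectorEquality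
open import Function.Bundles using (Injection; Inverse; _⇔_; Equivalence)
open import Relation.Binary.Bundles using (Setoid)
import Relation.Binary.Construct.On as On
open import Relation.Binary.Core using (Rel)
open import Relation.Binary.PropositionalEquality.Core using (_≡_)
import Relation.Binary.PropositionalEquality.Properties as ≡
open import Relation.Binary.Structures using (IsStrictPartialOrder)
open import Relation.Nullary.Negation.Core using (¬_)
open import Relation.Unary using (Pred; _∈_; _≐_; _≬_; Satisfiable)
open import Relation.Unary.Relation.Binary.Equality using (≐-setoid)

private variable
  a b ℓ p : Level

IsOddPrimePower : ℕ → Set
IsOddPrimePower q =
  ¬ (2 ∣ q) × (∃₂ λ r k → Prime r × 1 ℕ.≤ k × q ≡ r ℕ.^ k)

SubsetSetoid : (S : Setoid a b) → Pred (Setoid.Carrier S) p → Setoid (a ⊔ p) b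
SubsetSetoid S P = On.setoid S (proj₁ {B = P})

HasSize : Setoid a b → ℕ → Set (a ⊔ b)
HasSize S n = Inverse (≡.setoid (Fin n)) S

-- An ordered field in the constructive sense: classically these are exactly
-- the (totally) ordered fields, and ℝ is an instance both classically and
-- constructively. Totality up to apartness comes from #⇔<> together with
-- the cotransitivity and tightness of _#_.
record OrderedField c ℓ₁ ℓ₂ : Set (lsuc (c ⊔ ℓ₁ ⊔ ℓ₂)) where
  infix 4 _<_ _≤_
  field
    heytingField : HeytingField c ℓ₁ ℓ₂

  open HeytingField heytingField public

  field
    _<_                  : Rel Carrier ℓ₂
    isStrictPartialOrder : IsStrictPartialOrder _≈_ _<_
    #⇔<>                 : ∀ {x y} → x # y ⇔ (x < y ⊎ y < x)
    +-monoʳ-<            : ∀ z {x y} → x < y → x + z < y + z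
    *-pos                : ∀ {x y} → 0# < x → 0# < y → 0# < x * y

  open IsStrictPartialOrder isStrictPartialOrder public
    using (<-respˡ-≈; <-respʳ-≈)
    renaming (irrefl to <-irrefl; trans to <-trans)

  _≤_ : Rel Carrier ℓ₂
  x ≤ y = ¬ (y < x)

  private
    commutativeRing : CommutativeRing c ℓ₁
    commutativeRing = HeytingCommutativeRing.commutativeRing heytingCommutativeRing

    module R = CommutativeRing commutativeRing
    module RP = RingProperties R.ring

  ι : ℕ → Carrier
  ι n = n · 1#
    where open RawMonoidDefs R.+-rawMonoid using () renaming (_×_ to _·_)

  -- #⇒invertible inverts y - 0#, which is equal to y.
  infixl 7 _/_[_]
  _/_[_] : Carrier → (y : Carrier) → 0# < y → Carrier
  x / y [ 0<y ] = x * proj₁ (#⇒invertible (Equivalence.from #⇔<> (inj₂ 0<y)))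

  x<y⇒0<y-x : ∀ {x y} → x < y → 0# < y - x
  x<y⇒0<y-x {x} x<y = <-respˡ-≈ (R.-‿inverseʳ x) (+-monoʳ-< (- x) x<y)

  0<1 : 0# < 1#
  0<1 with Equivalence.to #⇔<> 1#0
    where
    1-0≈1 : 1# - 0# ≈ 1#
    1-0≈1 = R.trans (R.+-congˡ RP.-0#≈0#) (R.+-identityʳ 1#)

    1#0 : 1# # 0#
    1#0 = invertible⇒# (1# , R.trans (R.*-identityˡ _) 1-0≈1
                           , R.trans (R.*-identityʳ _) 1-0≈1)
  ... | inj₂ 0<1# = 0<1#
  ... | inj₁ 1<0  = <-respʳ-≈ -1*-1≈1 (*-pos 0<-1 0<-1)
    where
    0<-1 : 0# < - 1#
    0<-1 = <-respʳ-≈ (R.+-identityˡ (- 1#)) (x<y⇒0<y-x 1<0)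

    -1*-1≈1 : - 1# * - 1# ≈ 1#
    -1*-1≈1 = R.trans (RP.-1*x≈-x (- 1#)) (RP.-‿involutive 1#)

  0<ι : ∀ {n} → 0 ℕ.< n → 0# < ι n
  0<ι {suc zero}    _ = <-respʳ-≈ (R.sym (R.+-identityʳ 1#)) 0<1
  0<ι {suc (suc n)} _ =
    <-trans (0<ι {suc n} (ℕ.s≤s ℕ.z≤n))
            (<-respˡ-≈ (R.+-identityˡ _) (+-monoʳ-< (ι (suc n)) 0<1))

  -- Cardinality at most r: no family of pairwise distinct elements has more
  -- than r members. For a set of size n this says ι n ≤ r.
  AtMost : Setoid a b → Carrier → Set (a ⊔ b ⊔ ℓ₂)
  AtMost S r = ∀ n → Injection (≡.setoid (Fin n)) S → ι n ≤ r

-- A HeytingField whose carrier is finite has decidable _≈_ and _#_, so it is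
-- a field in the usual sense.
module Geometry {c ℓ₁ ℓ₂} (F : HeytingField c ℓ₁ ℓ₂) (d : ℕ) where

  open HeytingField F
  private
    module F = CommutativeRing
      (HeytingCommutativeRing.commutativeRing heytingCommutativeRing)
  open RawMonoidDefs F.+-rawMonoid using (sum)
  open VectorEquality F.setoid using (_≋_; ≋-setoid)

  Point : Set c
  Point = Vector Carrier d

  PointSetoid : Setoid c ℓ₁
  PointSetoid = ≋-setoid d

  0ᵥ : Point
  0ᵥ _ = 0#

  _+ᵥ_ : Point → Point → Point
  (x +ᵥ y) i = x i + y i

  _*ᵥ_ : Carrier → Point → Point
  (s *ᵥ x) i = s * x i

  infix 7 _∙_
  _∙_ : Point → Point → Carrier
  x ∙ y = sum (λ i → x i * y i)

  ‖_‖ : Point → Carrier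
  ‖ x ‖ = x ∙ x

  Sphere : Pred Point ℓ₁
  Sphere x = ‖ x ‖ ≈ 1#

  -- Fin counts from 0, so the last coordinate is the i with suc (toℕ i) ≡ d.
  Hyperplane : Carrier → Pred Point ℓ₁
  Hyperplane l x = ∃[ i ] suc (toℕ i) ≡ d × x i ≈ l

  -- Sets of sets of points are predicates on PointSet, whose elements are
  -- compared by extensional equality _≐_.
  PointSet : Set (lsuc (c ⊔ ℓ₁))
  PointSet = Pred Point (c ⊔ ℓ₁)

  PointSetSetoid : Setoid (lsuc (c ⊔ ℓ₁)) (c ⊔ ℓ₁)
  PointSetSetoid = ≐-setoid Point (c ⊔ ℓ₁)

  Span : Point → PointSet
  Span v x = ∃[ s ] x ≋ (s *ᵥ v)

  IsLine : Pred PointSet (c ⊔ ℓ₁)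
  IsLine V = ∃[ v ] ¬ (v ≋ 0ᵥ) × V ≐ Span v

  X : Carrier → Pred PointSet (c ⊔ ℓ₁)
  X l V = IsLine V ×
    (∃[ x ] ¬ (x ≋ 0ᵥ) × x ∈ V × x ∈ Hyperplane l × x ∈ Sphere)

  infix 9 _^⊥
  _^⊥ : PointSet → PointSet
  (V ^⊥) x = ∀ y → y ∈ V → x ∙ y ≈ 0#

  Coset : Point → PointSet → PointSet
  Coset x W y = ∃[ w ] w ∈ W × y ≋ (x +ᵥ w)

  Projection : PointSet → Pred Point p → Pred PointSet (c ⊔ ℓ₁ ⊔ p)
  Projection V E C = ∃[ x ] C ≐ Coset x (V ^⊥) × Coset x (V ^⊥) ≬ E

  module _ {r s₁ s₂} (R : OrderedField r s₁ s₂) where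
    private module R = OrderedField R

    T₁ : Pred PointSet a → Pred Point p → R.Carrier →
         Pred PointSet (a ⊔ lsuc (c ⊔ ℓ₁) ⊔ p ⊔ s₂)
    T₁ 𝒳 E N V =
      V ∈ 𝒳 × R.AtMost (SubsetSetoid PointSetSetoid (Projection V E)) N

size-positive : ∀ {S : Setoid a b} {P : Pred (Setoid.Carrier S) p} {m} →
                HasSize (SubsetSetoid S P) m → Satisfiable P → 0 ℕ.< m
size-positive {m = zero}  size x with () ← Inverse.from size x
size-positive {m = suc _} _    _ = ℕ.s≤s ℕ.z≤n

module _ {r s₁ s₂} (R : OrderedField r s₁ s₂) where
  open OrderedField R

  -- N q^(d-1) / ((q - N) m)  +  N q^k / (q - N)
  Bound : (q d m k : ℕ) (N : Carrier) → N < ι q → 0 ℕ.< m → Carrier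
  Bound q d m k N N<q 0<m =
    (N * ι (q ℕ.^ (d ℕ.∸ 1))) / ((ι q - N) * ι m) [ *-pos 0<q-N (0<ι 0<m) ]
      + (N * ι (q ℕ.^ k)) / (ι q - N) [ 0<q-N ]
    where
    0<q-N : 0# < ι q - N
    0<q-N = x<y⇒0<y-x N<q

{-# OPTIONS --safe #-}

-- A line in X_π is spanned by a unique (x, λ) with x on the isotropic cone ‖x‖ = 0 of
-- F^n, n = d − 1. Let Λ(x) count the pairs of points of E with equal product with (x, λ).
-- Cauchy–Schwarz gives |E|² ≤ |π_V(E)| Λ(x), and also |E|² ≤ q Λ(x), so the excess
-- q Λ(x) − |E|² is nonnegative and its sum over the given lines is at most its sum over
-- the whole cone C. The latter is controlled by the sections of C by affine hyperplanes:
-- a section has at most (|C| + q^k) / q points.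
--
-- No characters are needed for this. For a ≠ 0, each x solves s ‖x‖ + a·x = t for q, 0
-- or 1 values of s, with q values exactly on the section, while for each fixed s ≠ 0
-- completing the square turns the equation into ‖y‖ = t′. So it is enough that
-- q |{‖y‖ = t}| ≤ q^n + q^k for every t. The substitution x = u + y counts x² − y² = t,
-- which also counts x² + y² = t: directly if −1 is a square, and otherwise because
-- exactly two y satisfy y² = z or y² = −z, on counting with multiplicity. Adding two
-- variables at a time then gives the counts in every dimension.

module Submission where

open import Defs
open import Algebra.Apartness.Bundles using (HeytingField)
open import Data.Nat using (ℕ; _+_; _∸_; _/_; _%_; _≤_)
open import Data.Nat.Divisibility using (_∣_)
open import Data.Product using (_×_)
open import Data.Sum using (_⊎_)
open import Relation.Binary using (Setoid; _Respects_)
open import Relation.Binary.PropositionalEquality using (_≡_)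
open import Relation.Nullary using (¬_)
open import Relation.Unary using (Pred; Satisfiable)

open import Algebra.Apartness.Bundles using (HeytingCommutativeRing)
open import Algebra.Bundles using (CommutativeRing)
import Algebra.Apartness.Properties.HeytingCommutativeRing as HeytingProperties
import Algebra.Properties.Group as GroupProperties
import Algebra.Properties.Ring as RingProperties
import Algebra.Properties.Semiring.Mult as Mult
import Algebra.Properties.Semiring.Sum as SemiringSum
import Algebra.Solver.Ring.NaturalCoefficients.Default as SemiringSolver
open import Data.Fin using (Fin; zero; suc; _↑ˡ_; _↑ʳ_; remQuot)
import Data.Fin as Fin
import Data.Fin.Properties as Fin
open import Data.Nat using (zero; suc; _*_; _^_; _<_; z≤n; s≤s; >-nonZero)
import Data.Nat.DivMod as ℕ
import Data.Nat.Divisibility as ℕ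
import Data.Nat.Properties as ℕ
open import Data.Nat.Tactic.RingSolver using (solve-∀)
open import Data.Product using (∃; ∃₂; _,_; proj₁; proj₂; map₁; uncurry)
open import Data.Sum using (inj₁; inj₂; [_,_]′)
import Data.Vec.Functional as Vector
open import Data.Vec.Functional using (Vector)
open import Function using (_∘_; id; Equivalence; Injection; Inverse; mk↔ₛ′)
open import Function.Definitions using (Injective)
open import Relation.Binary using (_Preserves_⟶_)
open import Relation.Binary.PropositionalEquality using (refl; cong; cong₂; sym; trans; subst; module ≡-Reasoning)
import Relation.Binary.PropositionalEquality.Properties as ≡
import Relation.Binary.Reasoning.Setoid as SetoidReasoning
open import Relation.Nullary using (Dec; yes; no; contradiction)
open import Relation.Unary using (_∈_)

open SemiringSum ℕ.+-*-semiring
  using (sum; sum-cong-≗; ∑-distrib-+; ∑-comm; sum-permute; *-distribˡ-sum; *-distribʳ-sum; sum-syntax)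

-- Finite sums of natural numbers

⟦_⟧ : ∀ {p} {P : Set p} → Dec P → ℕ
⟦ yes _ ⟧ = 1
⟦ no  _ ⟧ = 0

module _ {p} {P : Set p} where

  ⟦⟧-true : (P? : Dec P) → P → ⟦ P? ⟧ ≡ 1
  ⟦⟧-true (yes _)  _ = refl
  ⟦⟧-true (no ¬p)  p = contradiction p ¬p

  ⟦⟧-false : (P? : Dec P) → ¬ P → ⟦ P? ⟧ ≡ 0
  ⟦⟧-false (yes p) ¬p = contradiction p ¬p
  ⟦⟧-false (no _)  _  = refl

  ⟦⟧-≤1 : (P? : Dec P) → ⟦ P? ⟧ ≤ 1
  ⟦⟧-≤1 (yes _) = ℕ.≤-refl
  ⟦⟧-≤1 (no _)  = z≤n

⟦⟧-cong : ∀ {p p′} {P : Set p} {P′ : Set p′} (P? : Dec P) (P′? : Dec P′) →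
          (P → P′) → (P′ → P) → ⟦ P? ⟧ ≡ ⟦ P′? ⟧
⟦⟧-cong (yes p) P′? f g = sym (⟦⟧-true P′? (f p))
⟦⟧-cong (no ¬p) P′? f g = sym (⟦⟧-false P′? (¬p ∘ g))

⟦⟧-× : ∀ {p p₁ p₂} {P : Set p} {P₁ : Set p₁} {P₂ : Set p₂} (P? : Dec P) (P₁? : Dec P₁) (P₂? : Dec P₂) →
       (P → P₁ × P₂) → (P₁ × P₂ → P) → ⟦ P? ⟧ ≡ ⟦ P₁? ⟧ * ⟦ P₂? ⟧
⟦⟧-× P? (yes p₁) (yes p₂) f g = ⟦⟧-true P? (g (p₁ , p₂))
⟦⟧-× P? (yes p₁) (no ¬p₂) f g = ⟦⟧-false P? (¬p₂ ∘ proj₂ ∘ f)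
⟦⟧-× P? (no ¬p₁) P₂?      f g = ⟦⟧-false P? (¬p₁ ∘ proj₁ ∘ f)

sum-mono-≤ : ∀ {n} {f g : Vector ℕ n} → (∀ i → f i ≤ g i) → sum f ≤ sum g
sum-mono-≤ {zero}  f≤g = z≤n
sum-mono-≤ {suc n} f≤g = ℕ.+-mono-≤ (f≤g zero) (sum-mono-≤ (f≤g ∘ suc))

sum-const : ∀ n x → ∑[ _ < n ] x ≡ n * x
sum-const zero    x = refl
sum-const (suc n) x = cong (x +_) (sum-const n x)

sum-zero : ∀ {n} {f : Vector ℕ n} → (∀ i → f i ≡ 0) → sum f ≡ 0
sum-zero {n} f≡0 = trans (sum-cong-≗ f≡0) (trans (sum-const n 0) (ℕ.*-zeroʳ n))

sum-δ : ∀ {n} (f : Vector ℕ n) j → ∑[ i < n ] (⟦ i Fin.≟ j ⟧ * f i) ≡ f j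
sum-δ {suc n} f zero    = trans (cong₂ _+_ (ℕ.*-identityˡ (f zero)) (sum-zero {n} λ _ → refl)) (ℕ.+-identityʳ _)
sum-δ {suc n} f (suc j) = trans (sum-cong-≗ λ i → cong (_* f (suc i))
  (⟦⟧-cong (suc i Fin.≟ suc j) (i Fin.≟ j) Fin.suc-injective (cong suc))) (sum-δ (f ∘ suc) j)

sum-⟦⟧-≤1 : ∀ {n p} {P : Fin n → Set p} (P? : ∀ i → Dec (P i)) →
            (∀ {i j} → P i → P j → i ≡ j) → ∑[ i < n ] ⟦ P? i ⟧ ≤ 1
sum-⟦⟧-≤1 {n} P? unique with Fin.any? P?
... | no ¬P         = ℕ.≤-trans (ℕ.≤-reflexive (sum-zero λ i → ⟦⟧-false (P? i) (λ Pi → ¬P (i , Pi)))) z≤n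
... | yes (j , Pj) = ℕ.≤-reflexive (trans (sum-cong-≗ λ i → trans
  (⟦⟧-cong (P? i) (i Fin.≟ j) (λ Pi → unique Pi Pj) (λ { refl → Pj })) (sym (ℕ.*-identityʳ _))) (sum-δ (λ _ → 1) j))

-- Equal totals leave no slack in any term. This turns an exact average into a pointwise identity.
sum-mono-≡ : ∀ {n} {f g : Vector ℕ n} → (∀ i → f i ≤ g i) → sum f ≡ sum g → ∀ i → f i ≡ g i
sum-mono-≡ {suc n} {f} {g} f≤g ∑f≡∑g = λ where
    zero    → f₀≡g₀
    (suc i) → sum-mono-≡ (f≤g ∘ suc)
                (ℕ.+-cancelˡ-≡ (f zero) _ _ (trans ∑f≡∑g (cong (_+ sum (g ∘ suc)) (sym f₀≡g₀)))) i
  where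
  f₀≡g₀ : f zero ≡ g zero
  f₀≡g₀ = ℕ.≤-antisym (f≤g zero) (ℕ.+-cancelʳ-≤ (sum (g ∘ suc)) _ _
    (subst (_≤ f zero + sum (g ∘ suc)) ∑f≡∑g (ℕ.+-monoʳ-≤ (f zero) (sum-mono-≤ (f≤g ∘ suc)))))

sum-∣ : ∀ {n k} {f : Vector ℕ n} → (∀ i → k ∣ f i) → k ∣ sum f
sum-∣ {zero}  k∣f = _ ℕ.∣0
sum-∣ {suc n} k∣f = ℕ.∣m∣n⇒∣m+n (k∣f zero) (sum-∣ (k∣f ∘ suc))

sum-*-sum : ∀ {m n} (f : Vector ℕ m) (g : Vector ℕ n) →
            sum f * sum g ≡ ∑[ i < m ] ∑[ j < n ] (f i * g j)
sum-*-sum f g = trans (*-distribʳ-sum (sum g) f) (sum-cong-≗ λ i → *-distribˡ-sum (f i) g)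

2ab≤a²+b² : ∀ a b → 2 * (a * b) ≤ a * a + b * b
2ab≤a²+b² a b = [ ordered a b , (λ b≤a → ℕ.≤-trans
    (ℕ.≤-reflexive (cong (2 *_) (ℕ.*-comm a b)))
    (ℕ.≤-trans (ordered b a b≤a) (ℕ.≤-reflexive (ℕ.+-comm (b * b) (a * a))))) ]′ (ℕ.≤-total a b)
  where
  ordered : ∀ a b → a ≤ b → 2 * (a * b) ≤ a * a + b * b
  ordered a b a≤b = subst (λ b → 2 * (a * b) ≤ a * a + b * b) (ℕ.m+[n∸m]≡n a≤b)
    (ℕ.≤-trans (ℕ.m≤m+n _ ((b ∸ a) * (b ∸ a))) (ℕ.≤-reflexive (identity a (b ∸ a))))
    where
    identity : ∀ a c → 2 * (a * (a + c)) + c * c ≡ a * a + (a + c) * (a + c)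
    identity = solve-∀

-- Expand the square into a double sum and apply `2ab ≤ a² + b²` to each term; the factor 2 is
-- cancelled at the end, so everything stays in the natural numbers.
cauchy-schwarz : ∀ {n} (f : Vector ℕ n) → sum f * sum f ≤ n * ∑[ i < n ] (f i * f i)
cauchy-schwarz {n} f = ℕ.*-cancelˡ-≤ 2 (begin
  2 * (sum f * sum f)
    ≡⟨ cong (2 *_) (sum-*-sum f f) ⟩
  2 * ∑[ i < n ] ∑[ j < n ] (f i * f j)
    ≡⟨ trans (*-distribˡ-sum 2 (λ i → ∑[ j < n ] (f i * f j))) (sum-cong-≗ λ i → *-distribˡ-sum 2 (λ j → f i * f j)) ⟩
  ∑[ i < n ] ∑[ j < n ] (2 * (f i * f j))
    ≤⟨ sum-mono-≤ (λ i → sum-mono-≤ (λ j → 2ab≤a²+b² (f i) (f j))) ⟩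
  ∑[ i < n ] ∑[ j < n ] (f i * f i + f j * f j)
    ≡⟨ sum-cong-≗ (λ i → trans (∑-distrib-+ (λ _ → f i * f i) (λ j → f j * f j)) (cong (_+ S) (sum-const n (f i * f i)))) ⟩
  ∑[ i < n ] (n * (f i * f i) + S)
    ≡⟨ ∑-distrib-+ (λ i → n * (f i * f i)) (λ _ → S) ⟩
  ∑[ i < n ] (n * (f i * f i)) + ∑[ i < n ] S
    ≡⟨ cong₂ _+_ (sym (*-distribˡ-sum n (λ i → f i * f i))) (sum-const n S) ⟩
  n * S + n * S
    ≡⟨ double (n * S) ⟩
  2 * (n * S) ∎)
  where
  open ℕ.≤-Reasoning
  S = ∑[ i < n ] (f i * f i)
  double : ∀ x → x + x ≡ 2 * x
  double = solve-∀

sum-↑ : ∀ m {n} (f : Vector ℕ (m + n)) → sum f ≡ sum (f ∘ (_↑ˡ n)) + sum (f ∘ (m ↑ʳ_))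
sum-↑ zero    f = refl
sum-↑ (suc m) f = trans (cong (f zero +_) (sum-↑ m (f ∘ suc))) (sym (ℕ.+-assoc (f zero) _ _))

sum-remQuot : ∀ m {n} (f : Fin m → Fin n → ℕ) →
              sum (uncurry f ∘ remQuot {m} n) ≡ ∑[ i < m ] ∑[ j < n ] f i j
sum-remQuot zero        f = refl
sum-remQuot (suc m) {n} f = trans (sum-↑ n (uncurry f ∘ remQuot {suc m} n)) (cong₂ _+_
  (sum-cong-≗ λ j → cong (uncurry f) (Fin.remQuot-combine {suc m} zero j))
  (trans (sum-cong-≗ λ k → cong (uncurry f) (remQuot-↑ʳ k)) (sum-remQuot m (f ∘ suc))))
  where
  remQuot-↑ʳ : ∀ k → remQuot {suc m} n (n ↑ʳ k) ≡ map₁ suc (remQuot {m} n k)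
  remQuot-↑ʳ k rewrite Fin.splitAt-↑ʳ n (m * n) k = refl

-- Listing the indices that satisfy `P` without repetition lets a sum be restricted to them.
-- Cauchy-Schwarz can then be applied with the number of attained values in place of the full index
-- size.
support : ∀ {n p} {P : Fin n → Set p} → (∀ i → Dec (P i)) →
          ∃₂ λ w (ρ : Fin w → Fin n) → (∀ i → P (ρ i)) × Injective _≡_ _≡_ ρ ×
            (∀ (f : Vector ℕ n) → (∀ i → ¬ P i → f i ≡ 0) → sum f ≡ sum (f ∘ ρ))
support {zero}  P? = 0 , (λ ()) , (λ ()) , (λ { {()} }) , λ _ _ → refl
support {suc n} {P = P} P? with support (P? ∘ suc) | P? zero
... | w , ρ , Pρ , ρ-inj , ∑ρ | no ¬P₀ =
  w , suc ∘ ρ , Pρ , ρ-inj ∘ Fin.suc-injective ,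
  λ f f≡0 → cong₂ _+_ (f≡0 zero ¬P₀) (∑ρ (f ∘ suc) (f≡0 ∘ suc))
... | w , ρ , Pρ , ρ-inj , ∑ρ | yes P₀ =
  suc w , ρ′ , (λ { zero → P₀ ; (suc i) → Pρ i }) , ρ′-inj ,
  λ f f≡0 → cong (f zero +_) (∑ρ (f ∘ suc) (f≡0 ∘ suc))
  where
  ρ′ : Fin (suc w) → Fin (suc n)
  ρ′ zero    = zero
  ρ′ (suc i) = suc (ρ i)
  ρ′-inj : Injective _≡_ _≡_ ρ′
  ρ′-inj {zero}  {zero}  _  = refl
  ρ′-inj {suc i} {suc j} eq = cong suc (ρ-inj (Fin.suc-injective eq))

-- The maximum is either 0 or a member of the family, so it inherits `P`. Only natural numbers are
-- compared, since the order of the ordered field that enters through `P` need not be decidable.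
upper-bound : ∀ {n p} (P : ℕ → Set p) → P 0 → (f : Vector ℕ n) → (∀ i → P (f i)) →
              ∃ λ w → P w × (∀ i → f i ≤ w)
upper-bound {zero}  P P0 f Pf = 0 , P0 , λ ()
upper-bound {suc n} P P0 f Pf with upper-bound P P0 (f ∘ suc) (Pf ∘ suc)
... | w , Pw , f≤w with ℕ.≤-total (f zero) w
...   | inj₁ f₀≤w = w , Pw , λ { zero → f₀≤w ; (suc i) → f≤w i }
...   | inj₂ w≤f₀ = f zero , Pf zero , λ { zero → ℕ.≤-refl ; (suc i) → ℕ.≤-trans (f≤w i) w≤f₀ }
-- Finite fields of odd order

module FiniteField {c ℓ₁ ℓ₂} (F : HeytingField c ℓ₁ ℓ₂) (q : ℕ) (q-odd : ¬ (2 ∣ q))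
                   (size : HasSize (HeytingField.setoid F) q) where

  open HeytingField F using (_#_; tight; #⇒invertible; heytingCommutativeRing)

  K : CommutativeRing c ℓ₁
  K = HeytingCommutativeRing.commutativeRing heytingCommutativeRing

  open CommutativeRing K
    hiding (zero)
    renaming (_+_ to infixl 6 _⊕_; _*_ to infixl 7 _⊗_; -_ to infix 8 ⊖_; _-_ to infixl 6 _⊝_;
              refl to ≈-refl; sym to ≈-sym; trans to ≈-trans; reflexive to ≈-reflexive)
  open GroupProperties +-group using (//-rightDividesˡ; //-rightDividesʳ)
  open RingProperties ring using (+-cancelˡ; -‿distribˡ-*; -‿distribʳ-*; -‿involutive; -0#≈0#)
  open HeytingProperties heytingCommutativeRing using (1#0)
  open SemiringSolver commutativeSemiring using (_:+_; _:*_; _:=_) renaming (solve to solveᶠ)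
  open Mult semiring using (×-congˡ) renaming (_×_ to infixr 8 _×ᶠ_)
  module ∑K = SemiringSum semiring
  module ≈-Reasoning = SetoidReasoning setoid

  ⊝-solve : ∀ {x y z} → x ≈ z ⊕ y → x ⊝ y ≈ z
  ⊝-solve {x} {y} {z} x≈z+y = ≈-trans (+-congʳ x≈z+y) (//-rightDividesʳ y z)

  x⊝y⊕y≈x : ∀ x y → x ⊝ y ⊕ y ≈ x
  x⊝y⊕y≈x x y = //-rightDividesˡ y x

  ⊝-unsolve : ∀ {x y z} → x ⊝ y ≈ z → x ≈ z ⊕ y
  ⊝-unsolve {x} {y} x-y≈z = ≈-trans (≈-sym (x⊝y⊕y≈x x y)) (+-congʳ x-y≈z)

  ⊝-cong : ∀ {x x′ y y′} → x ≈ x′ → y ≈ y′ → x ⊝ y ≈ x′ ⊝ y′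
  ⊝-cong x≈x′ y≈y′ = +-cong x≈x′ (-‿cong y≈y′)

  x≈y⇒x⊝y≈0 : ∀ {x y} → x ≈ y → x ⊝ y ≈ 0#
  x≈y⇒x⊝y≈0 x≈y = ⊝-solve (≈-trans x≈y (≈-sym (+-identityˡ _)))

  x⊝y≈0⇒x≈y : ∀ {x y} → x ⊝ y ≈ 0# → x ≈ y
  x⊝y≈0⇒x≈y x-y≈0 = ≈-trans (⊝-unsolve x-y≈0) (+-identityˡ _)

  -- Equality of differences, moved across so that the semiring solver applies.
  ⊝-cross : ∀ {x u y v} → x ⊕ v ≈ y ⊕ u → x ⊝ u ≈ y ⊝ v
  ⊝-cross {x} {u} {y} {v} x+v≈y+u = ⊝-solve (≈-sym (begin
    y ⊝ v ⊕ u      ≈⟨ +-assoc y (⊖ v) u ⟩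
    y ⊕ (⊖ v ⊕ u)  ≈⟨ +-congˡ (+-comm (⊖ v) u) ⟩
    y ⊕ (u ⊝ v)    ≈⟨ +-assoc y u (⊖ v) ⟨
    y ⊕ u ⊝ v      ≈⟨ ⊝-solve (≈-sym x+v≈y+u) ⟩
    x              ∎))
    where open ≈-Reasoning

  elem : Fin q → Carrier
  elem = Inverse.to size

  index : Carrier → Fin q
  index = Inverse.from size

  elem-index : ∀ x → elem (index x) ≈ x
  elem-index = Inverse.strictlyInverseˡ size

  index-elem : ∀ i → index (elem i) ≡ i
  index-elem = Inverse.strictlyInverseʳ size

  index-cong : ∀ {x y} → x ≈ y → index x ≡ index y
  index-cong = Inverse.from-cong size

  index-injective : ∀ {x y} → index x ≡ index y → x ≈ y
  index-injective {x} {y} eq =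
    ≈-trans (≈-sym (elem-index x)) (≈-trans (≈-reflexive (cong elem eq)) (elem-index y))

  infix 4 _≈?_
  _≈?_ : ∀ x y → Dec (x ≈ y)
  x ≈? y with index x Fin.≟ index y
  ... | yes eq = yes (index-injective eq)
  ... | no ¬eq = no (¬eq ∘ index-cong)

  1≉0 : ¬ 1# ≈ 0#
  1≉0 1≈0 = proj₂ (tight 1# 0#) 1≈0 1#0

  -- By `tight` it suffices to refute `y # z`. Apartness would make `y - z` invertible, and since
  -- `x` annihilates it, `x` would vanish.
  *-cancelˡ : ∀ {x y z} → ¬ x ≈ 0# → x ⊗ y ≈ x ⊗ z → y ≈ z
  *-cancelˡ {x} {y} {z} x≉0 xy≈xz = proj₁ (tight y z) λ y#z → x≉0 (x≈0 (#⇒invertible y#z))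
    where
    open ≈-Reasoning
    x≈0 : ∃ (λ i → i ⊗ (y ⊝ z) ≈ 1# × (y ⊝ z) ⊗ i ≈ 1#) → x ≈ 0#
    x≈0 (i , _ , [y-z]i≈1) = begin
      x                        ≈⟨ *-identityʳ x ⟨
      x ⊗ 1#                   ≈⟨ *-congˡ [y-z]i≈1 ⟨
      x ⊗ ((y ⊝ z) ⊗ i)        ≈⟨ *-assoc x (y ⊝ z) i ⟨
      x ⊗ (y ⊝ z) ⊗ i          ≈⟨ *-congʳ (distribˡ x y (⊖ z)) ⟩
      (x ⊗ y ⊕ x ⊗ (⊖ z)) ⊗ i  ≈⟨ *-congʳ (+-congˡ (-‿distribʳ-* x z)) ⟨
      (x ⊗ y ⊝ x ⊗ z) ⊗ i      ≈⟨ *-congʳ (x≈y⇒x⊝y≈0 xy≈xz) ⟩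
      0# ⊗ i                   ≈⟨ zeroˡ i ⟩
      0#                       ∎

  zero-product : ∀ {x y} → ¬ x ≈ 0# → x ⊗ y ≈ 0# → y ≈ 0#
  zero-product {x} x≉0 xy≈0 = *-cancelˡ x≉0 (≈-trans xy≈0 (≈-sym (zeroʳ x)))

  -- Apartness from 0 is not available from x ≉ 0; instead multiplication by x is
  -- injective on a finite set, so it cannot miss 1.
  invert : ∀ {x} → ¬ x ≈ 0# → ∃ λ y → x ⊗ y ≈ 1#
  invert {x} x≉0 with Fin.any? (λ i → x ⊗ elem i ≈? 1#)
  ... | yes (i , xi≈1) = elem i , xi≈1
  ... | no  ¬xi≈1      = contradiction (Fin.injective⇒≤ f-injective) ℕ.1+n≰n
    where
    f : Fin (suc q) → Fin q
    f zero    = index 1#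
    f (suc i) = index (x ⊗ elem i)
    f-injective : Injective _≡_ _≡_ f
    f-injective {zero}  {zero}  _  = refl
    f-injective {zero}  {suc j} eq = contradiction (j , ≈-sym (index-injective eq)) ¬xi≈1
    f-injective {suc i} {zero}  eq = contradiction (i , index-injective eq) ¬xi≈1
    f-injective {suc i} {suc j} eq = cong suc (trans (sym (index-elem i))
      (trans (index-cong (*-cancelˡ x≉0 (index-injective eq))) (index-elem j)))

  -- Sums over the field and their changes of variable.

  module _ (φ ψ : Carrier → Carrier) (φ-cong : φ Preserves _≈_ ⟶ _≈_) (ψ-cong : ψ Preserves _≈_ ⟶ _≈_)
           (φψ : ∀ x → φ (ψ x) ≈ x) (ψφ : ∀ x → ψ (φ x) ≈ x) where

    permutation : Inverse (≡.setoid (Fin q)) (≡.setoid (Fin q))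
    permutation = mk↔ₛ′ (index ∘ φ ∘ elem) (index ∘ ψ ∘ elem)
      (λ i → trans (index-cong (≈-trans (φ-cong (elem-index _)) (φψ _))) (index-elem i))
      (λ i → trans (index-cong (≈-trans (ψ-cong (elem-index _)) (ψφ _))) (index-elem i))

  ∑ᶠ : (Carrier → ℕ) → ℕ
  ∑ᶠ g = sum (g ∘ elem)

  ∑ᶠ-cong : ∀ {g h} → (∀ x → g x ≡ h x) → ∑ᶠ g ≡ ∑ᶠ h
  ∑ᶠ-cong g≗h = sum-cong-≗ (g≗h ∘ elem)

  ∑ᶠ-reindex : ∀ {g} → g Preserves _≈_ ⟶ _≡_ → (φ ψ : Carrier → Carrier) →
               φ Preserves _≈_ ⟶ _≈_ → ψ Preserves _≈_ ⟶ _≈_ →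
               (∀ x → φ (ψ x) ≈ x) → (∀ x → ψ (φ x) ≈ x) → ∑ᶠ (g ∘ φ) ≡ ∑ᶠ g
  ∑ᶠ-reindex {g} g-cong φ ψ φ-cong ψ-cong φψ ψφ = sym (trans
    (sum-permute (g ∘ elem) (permutation φ ψ φ-cong ψ-cong φψ ψφ))
    (sum-cong-≗ λ i → g-cong (elem-index (φ (elem i)))))

  ∑ᶠ-translate : ∀ {g} → g Preserves _≈_ ⟶ _≡_ → ∀ u → ∑ᶠ (λ x → g (x ⊕ u)) ≡ ∑ᶠ g
  ∑ᶠ-translate g-cong u = ∑ᶠ-reindex g-cong (_⊕ u) (_⊝ u) +-congʳ +-congʳ
    (λ x → x⊝y⊕y≈x x u) (λ x → ⊝-solve ≈-refl)

  ∑ᶠ-scale : ∀ {g} → g Preserves _≈_ ⟶ _≡_ → ∀ {u} → ¬ u ≈ 0# → ∑ᶠ (λ x → g (u ⊗ x)) ≡ ∑ᶠ g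
  ∑ᶠ-scale g-cong {u} u≉0 = ∑ᶠ-reindex g-cong (u ⊗_) (v ⊗_) *-congˡ *-congˡ
    (λ x → ≈-trans (≈-sym (*-assoc u v x)) (≈-trans (*-congʳ uv≈1) (*-identityˡ x)))
    (λ x → ≈-trans (≈-sym (*-assoc v u x)) (≈-trans (*-congʳ (≈-trans (*-comm v u) uv≈1)) (*-identityˡ x)))
    where
    v = proj₁ (invert u≉0)
    uv≈1 = proj₂ (invert u≉0)

  ∑ᶠ-reflect : ∀ {g} → g Preserves _≈_ ⟶ _≡_ → ∀ t → ∑ᶠ (λ x → g (t ⊝ x)) ≡ ∑ᶠ g
  ∑ᶠ-reflect g-cong t = ∑ᶠ-reindex g-cong (t ⊝_) (t ⊝_) (⊝-cong ≈-refl) (⊝-cong ≈-refl) involutive involutive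
    where
    involutive : ∀ x → t ⊝ (t ⊝ x) ≈ x
    involutive x = ⊝-solve (≈-sym (≈-trans (+-comm x (t ⊝ x)) (x⊝y⊕y≈x t x)))

  ∑ᶠ-δ : ∀ {g} → g Preserves _≈_ ⟶ _≡_ → ∀ y → ∑ᶠ (λ x → ⟦ y ≈? x ⟧ * g x) ≡ g y
  ∑ᶠ-δ {g} g-cong y = trans
    (sum-cong-≗ λ i → cong (_* g (elem i)) (⟦⟧-cong (y ≈? elem i) (i Fin.≟ index y)
      (λ y≈i → trans (sym (index-elem i)) (index-cong (≈-sym y≈i)))
      (λ i≡y → ≈-sym (≈-trans (≈-reflexive (cong elem i≡y)) (elem-index y)))))
    (trans (sum-δ (g ∘ elem) (index y)) (g-cong (elem-index y)))

  ⟦≈⟧-congˡ : ∀ {x y y′} → y ≈ y′ → ⟦ x ≈? y ⟧ ≡ ⟦ x ≈? y′ ⟧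
  ⟦≈⟧-congˡ y≈y′ = ⟦⟧-cong (_ ≈? _) (_ ≈? _) (λ e → ≈-trans e y≈y′) (λ e → ≈-trans e (≈-sym y≈y′))

  ⟦≈⟧-congʳ : ∀ {x x′ y} → x ≈ x′ → ⟦ x ≈? y ⟧ ≡ ⟦ x′ ≈? y ⟧
  ⟦≈⟧-congʳ x≈x′ = ⟦⟧-cong (_ ≈? _) (_ ≈? _) (≈-trans (≈-sym x≈x′)) (≈-trans x≈x′)

  ∑ᶠ-point : ∀ y → ∑ᶠ (λ x → ⟦ y ≈? x ⟧) ≡ 1
  ∑ᶠ-point y = trans (∑ᶠ-cong λ x → sym (ℕ.*-identityʳ ⟦ y ≈? x ⟧)) (∑ᶠ-δ (λ _ → refl) y)

  -- Translation by 1 permutes the field, so q · 1 = 0.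
  q×1≈0 : q ×ᶠ 1# ≈ 0#
  q×1≈0 = ≈-sym (≈-trans (≈-sym (-‿inverseˡ S)) (≈-trans (+-congˡ S≈S+q×1)
    (≈-trans (≈-sym (+-assoc _ _ _)) (≈-trans (+-congʳ (-‿inverseˡ S)) (+-identityˡ _)))))
    where
    S = ∑K.sum elem
    S≈S+q×1 : S ≈ S ⊕ q ×ᶠ 1#
    S≈S+q×1 = begin
      S
        ≈⟨ ∑K.sum-permute elem (permutation (_⊕ 1#) (_⊝ 1#) +-congʳ +-congʳ
             (λ x → x⊝y⊕y≈x x 1#) (λ x → ⊝-solve ≈-refl)) ⟩
      ∑K.sum (λ i → elem (index (elem i ⊕ 1#)))
        ≈⟨ ∑K.sum-cong-≋ (λ i → elem-index (elem i ⊕ 1#)) ⟩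
      ∑K.sum (λ i → elem i ⊕ 1#)
        ≈⟨ ∑K.∑-distrib-+ elem (λ _ → 1#) ⟩
      S ⊕ ∑K.sum {q} (λ _ → 1#)
        ≈⟨ +-congˡ (∑K.sum-replicate q) ⟩
      S ⊕ q ×ᶠ 1# ∎
      where open ≈-Reasoning

  -- If `1 + 1` vanished, the odd multiple `q · 1` would collapse to `1`, whereas it is `0`.
  2≉0 : ¬ 1# ⊕ 1# ≈ 0#
  2≉0 2≈0 = 1≉0 (begin
    1#                            ≈⟨ +-identityʳ 1# ⟨
    1# ⊕ 0#                       ≈⟨ +-congˡ (even≈0 (q ℕ./ 2)) ⟨
    1# ⊕ (q ℕ./ 2 * 2) ×ᶠ 1#   ≈⟨ ×-congˡ q≡1+2h ⟨
    q ×ᶠ 1#                    ≈⟨ q×1≈0 ⟩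
    0#                            ∎)
    where
    open ≈-Reasoning
    even≈0 : ∀ h → (h * 2) ×ᶠ 1# ≈ 0#
    even≈0 zero    = ≈-refl
    even≈0 (suc h) = ≈-trans (≈-sym (+-assoc 1# 1# _)) (≈-trans (+-cong 2≈0 (even≈0 h)) (+-identityˡ 0#))
    q≡1+2h : q ≡ 1 + q ℕ./ 2 * 2
    q≡1+2h with q ℕ.% 2 | ℕ.m%n<n q 2 | ℕ.m≡m%n+[m/n]*n q 2 | ℕ.m%n≡0⇒n∣m q 2
    ... | zero        | _ | _  | 2∣q = contradiction (2∣q refl) q-odd
    ... | suc zero    | _ | eq | _   = eq
    ... | suc (suc _) | s≤s (s≤s ()) | _ | _

  half : ∃ λ h → ∀ x → h ⊗ x ⊕ h ⊗ x ≈ x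
  half = h , λ x → begin
    h ⊗ x ⊕ h ⊗ x                  ≈⟨ solveᶠ 2 (λ h x → h :* x :+ h :* x := (h :+ h) :* x) ≈-refl h x ⟩
    (h ⊕ h) ⊗ x                    ≈⟨ *-congʳ (+-cong (*-identityˡ h) (*-identityˡ h)) ⟨
    (1# ⊗ h ⊕ 1# ⊗ h) ⊗ x          ≈⟨ *-congʳ (distribʳ h 1# 1#) ⟨
    (1# ⊕ 1#) ⊗ h ⊗ x              ≈⟨ *-congʳ (proj₂ (invert 2≉0)) ⟩
    1# ⊗ x                         ≈⟨ *-identityˡ x ⟩
    x                              ∎
    where
    open ≈-Reasoning
    h = proj₁ (invert 2≉0)

  double≈0 : ∀ {x} → x ⊕ x ≈ 0# → x ≈ 0#
  double≈0 {x} 2x≈0 = zero-product 2≉0 (≈-trans (distribʳ x 1# 1#)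
    (≈-trans (+-cong (*-identityˡ x) (*-identityˡ x)) 2x≈0))
  ⟦⊕≈⟧ : ∀ u v t → ⟦ u ⊕ v ≈? t ⟧ ≡ ⟦ v ≈? t ⊝ u ⟧
  ⟦⊕≈⟧ u v t = ⟦⟧-cong (u ⊕ v ≈? t) (v ≈? t ⊝ u)
    (λ u+v≈t → ≈-sym (⊝-solve (≈-trans (≈-sym u+v≈t) (+-comm u v))))
    (λ v≈t-u → ≈-trans (+-comm u v) (≈-sym (⊝-unsolve (≈-sym v≈t-u))))

  -- Level sets of diagonal forms

  points : ∀ n → Fin (q ^ n) → Vector Carrier n
  points zero    _ = Vector.[]
  points (suc n) i = uncurry (λ a x → elem a Vector.∷ points n x) (remQuot {q} (q ^ n) i)

  ∑ᵛ : ∀ n → (Vector Carrier n → ℕ) → ℕ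
  ∑ᵛ n g = sum (g ∘ points n)

  ∑ᵛ-suc : ∀ n g → ∑ᵛ (suc n) g ≡ ∑ᶠ (λ a → ∑ᵛ n (λ x → g (a Vector.∷ x)))
  ∑ᵛ-suc n g = sum-remQuot q (λ i j → g (elem i Vector.∷ points n j))

  -- Allowing a separate function in each coordinate covers linear forms, the form `‖x‖` and the
  -- mixed form `s ‖x‖ + a·x` at once, and lets coordinates be split off one at a time.
  fibre : ∀ n → (Fin n → Carrier → Carrier) → Carrier → ℕ
  fibre n f t = ∑ᵛ n (λ x → ⟦ ∑K.sum (λ i → f i (x i)) ≈? t ⟧)

  fibre-cong : ∀ n f → fibre n f Preserves _≈_ ⟶ _≡_
  fibre-cong n f t≈t′ = sum-cong-≗ {q ^ n} λ _ → ⟦≈⟧-congˡ t≈t′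

  fibre-suc : ∀ n f t → fibre (suc n) f t ≡ ∑ᶠ (λ a → fibre n (f ∘ suc) (t ⊝ f zero a))
  fibre-suc n f t = trans (∑ᵛ-suc n (λ x → ⟦ ∑K.sum (λ i → f i (x i)) ≈? t ⟧)) 
    (sum-cong-≗ {q} λ i → sum-cong-≗ {q ^ n} λ j → ⟦⊕≈⟧ (f zero (elem i)) (∑K.sum (λ k → f (suc k) (points n j k))) t)

  ∑ᶠ-fibre : ∀ n f → ∑ᶠ (fibre n f) ≡ q ^ n
  ∑ᶠ-fibre n f = begin
    ∑ᶠ (fibre n f)
      ≡⟨ ∑-comm (λ i j → ⟦ ∑K.sum (λ k → f k (points n j k)) ≈? elem i ⟧) ⟩
    ∑ᵛ n (λ x → ∑ᶠ (λ t → ⟦ ∑K.sum (λ k → f k (x k)) ≈? t ⟧))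
      ≡⟨ sum-cong-≗ {q ^ n} (λ j → ∑ᶠ-point _) ⟩
    ∑[ _ < q ^ n ] 1
      ≡⟨ trans (sum-const (q ^ n) 1) (ℕ.*-identityʳ _) ⟩
    q ^ n ∎
    where open ≡-Reasoning

  -- If the leading coefficient is nonzero, its term takes every value once, so the fibres of the
  -- remaining form over all levels are added up. If it is zero, that coordinate is free and
  -- contributes a factor `q` to the count for the tail. The factor `q` on the left avoids the
  -- exponent `n - 1`.
  fibre-linear : ∀ n (a : Vector Carrier n) → ¬ (∀ i → a i ≈ 0#) →
                 ∀ t → q * fibre n (λ i x → a i ⊗ x) t ≡ q ^ n
  fibre-linear zero    a a≉0 t = contradiction (λ ()) a≉0
  fibre-linear (suc n) a a≉0 t with a zero ≈? 0#
  ... | no a₀≉0 = cong (q *_) (begin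
    fibre (suc n) (λ i x → a i ⊗ x) t      ≡⟨ fibre-suc n (λ i x → a i ⊗ x) t ⟩
    ∑ᶠ (λ x → fibre n f (t ⊝ a zero ⊗ x))  ≡⟨ ∑ᶠ-scale (λ x≈y → fibre-cong n f (⊝-cong ≈-refl x≈y)) a₀≉0 ⟩
    ∑ᶠ (λ x → fibre n f (t ⊝ x))           ≡⟨ ∑ᶠ-reflect (fibre-cong n f) t ⟩
    ∑ᶠ (fibre n f)                         ≡⟨ ∑ᶠ-fibre n f ⟩
    q ^ n                                  ∎)
    where
    open ≡-Reasoning
    f = λ i x → a (suc i) ⊗ x
  ... | yes a₀≈0 = begin
    q * fibre (suc n) (λ i x → a i ⊗ x) t        ≡⟨ cong (q *_) (fibre-suc n (λ i x → a i ⊗ x) t) ⟩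
    q * ∑ᶠ (λ x → fibre n f (t ⊝ a zero ⊗ x))    ≡⟨ *-distribˡ-sum q (λ i → fibre n f (t ⊝ a zero ⊗ elem i)) ⟩
    ∑ᶠ (λ x → q * fibre n f (t ⊝ a zero ⊗ x))    ≡⟨ sum-cong-≗ {q} (λ i → fibre-linear n (a ∘ suc) tail≉0 _) ⟩
    ∑[ _ < q ] (q ^ n)                           ≡⟨ sum-const q (q ^ n) ⟩
    q * q ^ n                                    ∎
    where
    open ≡-Reasoning
    f = λ i x → a (suc i) ⊗ x
    tail≉0 : ¬ (∀ i → a (suc i) ≈ 0#)
    tail≉0 tail≈0 = a≉0 λ { zero → a₀≈0 ; (suc i) → tail≈0 i }

  quadric : ∀ n → Carrier → ℕ
  quadric n = fibre n (λ _ x → x ⊗ x)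

  module _ {s : Carrier} (s≉0 : ¬ s ≈ 0#) where

    private
      r = proj₁ (invert s≉0)

    -- Divide by `s` and shift each coordinate by half of its linear coefficient over `s`; the
    -- squares of the shifts accumulate in `τ`. Its value is left unspecified because the bounds on
    -- `quadric` hold uniformly in the level.
    completing-the-square : ∀ n (a : Vector Carrier n) →
      ∃ λ τ → ∀ t → fibre n (λ i x → s ⊗ (x ⊗ x) ⊕ a i ⊗ x) t ≡ quadric n (r ⊗ t ⊕ τ)
    completing-the-square zero a = 0# , λ t → cong (_+ 0) (⟦⟧-cong (0# ≈? t) (0# ≈? r ⊗ t ⊕ 0#)
      (λ 0≈t → ≈-sym (≈-trans (+-identityʳ _) (≈-trans (*-congˡ (≈-sym 0≈t)) (zeroʳ r))))
      (λ 0≈rt → ≈-sym (zero-product r≉0 (≈-trans (≈-sym (+-identityʳ _)) (≈-sym 0≈rt)))))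
      where
      r≉0 : ¬ r ≈ 0#
      r≉0 r≈0 = 1≉0 (≈-trans (≈-sym (proj₂ (invert s≉0))) (≈-trans (*-congˡ r≈0) (zeroʳ s)))
    completing-the-square (suc n) a = g ⊗ g ⊕ τ , λ t → begin
      fibre (suc n) (λ i x → s ⊗ (x ⊗ x) ⊕ a i ⊗ x) t
        ≡⟨ fibre-suc n (λ i x → s ⊗ (x ⊗ x) ⊕ a i ⊗ x) t ⟩
      ∑ᶠ (λ x → fibre n (λ i x → s ⊗ (x ⊗ x) ⊕ a (suc i) ⊗ x) (t ⊝ (s ⊗ (x ⊗ x) ⊕ a zero ⊗ x)))
        ≡⟨ ∑ᶠ-cong (λ x → trans (shift _) (fibre-cong n (λ _ x → x ⊗ x) (square t x))) ⟩
      ∑ᶠ (λ x → quadric n (r ⊗ t ⊕ (g ⊗ g ⊕ τ) ⊝ (x ⊕ g) ⊗ (x ⊕ g)))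
        ≡⟨ ∑ᶠ-translate {λ x → quadric n (r ⊗ t ⊕ (g ⊗ g ⊕ τ) ⊝ x ⊗ x)}
             (λ x≈y → fibre-cong n (λ _ x → x ⊗ x) (⊝-cong ≈-refl (*-cong x≈y x≈y))) g ⟩
      ∑ᶠ (λ x → quadric n (r ⊗ t ⊕ (g ⊗ g ⊕ τ) ⊝ x ⊗ x))
        ≡⟨ fibre-suc n (λ _ x → x ⊗ x) _ ⟨
      quadric (suc n) (r ⊗ t ⊕ (g ⊗ g ⊕ τ)) ∎
      where
      open ≡-Reasoning
      τ     = proj₁ (completing-the-square n (a ∘ suc))
      shift = proj₂ (completing-the-square n (a ∘ suc))
      g     = proj₁ half ⊗ (r ⊗ a zero)
      scaled : ∀ x → r ⊗ (s ⊗ (x ⊗ x) ⊕ a zero ⊗ x) ≈ x ⊗ x ⊕ (g ⊕ g) ⊗ x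
      scaled x = ≈-trans
        (solveᶠ 4 (λ r s a x → r :* (s :* (x :* x) :+ a :* x) := (s :* r) :* (x :* x) :+ (r :* a) :* x)
           ≈-refl r s (a zero) x)
        (+-cong (≈-trans (*-congʳ (proj₂ (invert s≉0))) (*-identityˡ _)) (*-congʳ (≈-sym (proj₂ half (r ⊗ a zero)))))
      square : ∀ t x → r ⊗ (t ⊝ (s ⊗ (x ⊗ x) ⊕ a zero ⊗ x)) ⊕ τ ≈ r ⊗ t ⊕ (g ⊗ g ⊕ τ) ⊝ (x ⊕ g) ⊗ (x ⊕ g)
      square t x = begin′
        r ⊗ (t ⊝ p) ⊕ τ                  ≈⟨ +-congʳ (≈-trans (distribˡ r t (⊖ p)) (+-congˡ (≈-sym (-‿distribʳ-* r p)))) ⟩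
        r ⊗ t ⊝ r ⊗ p ⊕ τ                ≈⟨ +-congʳ (⊝-cong ≈-refl (scaled x)) ⟩
        r ⊗ t ⊝ (x ⊗ x ⊕ (g ⊕ g) ⊗ x) ⊕ τ ≈⟨ ≈-trans (+-assoc _ _ _) (≈-trans (+-congˡ (+-comm _ _)) (≈-sym (+-assoc _ _ _))) ⟩
        r ⊗ t ⊕ τ ⊝ (x ⊗ x ⊕ (g ⊕ g) ⊗ x)
          ≈⟨ ⊝-cross (solveᶠ 4 (λ w τ g x → (w :+ τ) :+ (x :+ g) :* (x :+ g) :=
                                 (w :+ (g :* g :+ τ)) :+ (x :* x :+ (g :+ g) :* x)) ≈-refl (r ⊗ t) τ g x) ⟩
        r ⊗ t ⊕ (g ⊗ g ⊕ τ) ⊝ (x ⊕ g) ⊗ (x ⊕ g) ∎′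
        where
        open ≈-Reasoning renaming (begin_ to begin′_; _∎ to _∎′)
        p = s ⊗ (x ⊗ x) ⊕ a zero ⊗ x

  -- Square roots and binary quadratic forms

  IsSquare : Carrier → Set _
  IsSquare z = ∃ λ x → x ⊗ x ≈ z

  isSquare? : ∀ z → Dec (IsSquare z)
  isSquare? z with Fin.any? (λ i → elem i ⊗ elem i ≈? z)
  ... | yes (i , i²≈z) = yes (elem i , i²≈z)
  ... | no  ¬i²≈z      = no λ (x , x²≈z) →
    ¬i²≈z (index x , ≈-trans (*-cong (elem-index x) (elem-index x)) x²≈z)

  roots : Carrier → ℕ
  roots z = ∑ᶠ (λ y → ⟦ y ⊗ y ≈? z ⟧)

  roots-cong : roots Preserves _≈_ ⟶ _≡_
  roots-cong z≈z′ = sum-cong-≗ {q} λ _ → ⟦≈⟧-congˡ z≈z′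

  [⊖x]²≈x² : ∀ x → ⊖ x ⊗ ⊖ x ≈ x ⊗ x
  [⊖x]²≈x² x = ≈-trans (≈-sym (-‿distribˡ-* x (⊖ x)))
    (≈-trans (-‿cong (≈-sym (-‿distribʳ-* x x))) (-‿involutive (x ⊗ x)))

  square≈0 : ∀ {x} → x ⊗ x ≈ 0# → x ≈ 0#
  square≈0 {x} x²≈0 with x ≈? 0#
  ... | yes x≈0 = x≈0
  ... | no  x≉0 = zero-product x≉0 x²≈0

  squares-≈ : ∀ {w y} → y ⊗ y ≈ w ⊗ w → w ≈ y ⊎ ⊖ w ≈ y
  squares-≈ {w} {y} y²≈w² with y ⊝ w ≈? 0#
  ... | yes y-w≈0 = inj₁ (≈-sym (x⊝y≈0⇒x≈y y-w≈0))
  ... | no  y-w≉0 = inj₂ (≈-trans (≈-sym (+-identityˡ (⊖ w)))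
    (⊝-solve (≈-sym (zero-product y-w≉0 [y-w][y+w]≈0))))
    where
    [y-w][y+w]≈0 : (y ⊝ w) ⊗ (y ⊕ w) ≈ 0#
    [y-w][y+w]≈0 = ≈-trans (distribʳ (y ⊕ w) y (⊖ w)) (≈-trans (+-congˡ (≈-sym (-‿distribˡ-* w (y ⊕ w))))
      (x≈y⇒x⊝y≈0 (≈-trans (distribˡ y y w) (≈-trans (+-congʳ y²≈w²)
        (solveᶠ 2 (λ w y → w :* w :+ y :* w := w :* (y :+ w)) ≈-refl w y)))))

  roots-0 : ∀ {z} → z ≈ 0# → roots z ≡ 1
  roots-0 {z} z≈0 = trans (∑ᶠ-cong λ y → ⟦⟧-cong (y ⊗ y ≈? z) (0# ≈? y)
      (λ y²≈z → ≈-sym (square≈0 (≈-trans y²≈z z≈0)))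
      (λ 0≈y → ≈-trans (*-congʳ (≈-sym 0≈y)) (≈-trans (zeroˡ y) (≈-sym z≈0))))
    (∑ᶠ-point 0#)

  roots-square : ∀ {w z} → w ⊗ w ≈ z → ¬ z ≈ 0# → roots z ≡ 2
  roots-square {w} {z} w²≈z z≉0 = trans (∑ᶠ-cong split)
    (trans (∑-distrib-+ (λ i → ⟦ w ≈? elem i ⟧) (λ i → ⟦ ⊖ w ≈? elem i ⟧)) (cong₂ _+_ (∑ᶠ-point w) (∑ᶠ-point (⊖ w))))
    where
    split : ∀ y → ⟦ y ⊗ y ≈? z ⟧ ≡ ⟦ w ≈? y ⟧ + ⟦ ⊖ w ≈? y ⟧
    split y with w ≈? y | ⊖ w ≈? y
    -- The two roots are distinct: `w = -w` gives `2w = 0`, hence `w = 0` and `z = 0`.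
    ... | yes w≈y | yes -w≈y = contradiction (≈-trans (≈-sym w²≈z) (≈-trans (*-congʳ w≈0) (zeroˡ w))) z≉0
      where
      w≈0 : w ≈ 0#
      w≈0 = double≈0 (≈-trans (+-congˡ (≈-trans w≈y (≈-sym -w≈y))) (-‿inverseʳ w))
    ... | yes w≈y | no _     = ⟦⟧-true (y ⊗ y ≈? z) (≈-trans (*-cong (≈-sym w≈y) (≈-sym w≈y)) w²≈z)
    ... | no _    | yes -w≈y = ⟦⟧-true (y ⊗ y ≈? z)
      (≈-trans (*-cong (≈-sym -w≈y) (≈-sym -w≈y)) (≈-trans ([⊖x]²≈x² w) w²≈z))
    ... | no w≉y  | no -w≉y  = ⟦⟧-false (y ⊗ y ≈? z)
      (λ y²≈z → [ w≉y , -w≉y ]′ (squares-≈ (≈-trans y²≈z (≈-sym w²≈z))))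

  roots-nonsquare : ∀ {z} → ¬ IsSquare z → roots z ≡ 0
  roots-nonsquare {z} ¬sq = sum-zero λ i → ⟦⟧-false (elem i ⊗ elem i ≈? z) (λ i²≈z → ¬sq (elem i , i²≈z))

  roots-even : ∀ {z} → ¬ z ≈ 0# → 2 ∣ roots z
  roots-even {z} z≉0 with isSquare? z
  ... | yes (w , w²≈z) = subst (2 ∣_) (sym (roots-square w²≈z z≉0)) ℕ.∣-refl
  ... | no ¬sq         = subst (2 ∣_) (sym (roots-nonsquare ¬sq)) (2 ℕ.∣0)

  roots-≤2 : ∀ z → roots z ≤ 2
  roots-≤2 z with z ≈? 0# | isSquare? z
  ... | yes z≈0 | _              = ℕ.≤-trans (ℕ.≤-reflexive (roots-0 z≈0)) (s≤s z≤n)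
  ... | no z≉0  | yes (w , w²≈z) = ℕ.≤-reflexive (roots-square w²≈z z≉0)
  ... | no _    | no ¬sq         = ℕ.≤-trans (ℕ.≤-reflexive (roots-nonsquare ¬sq)) z≤n

  ∑ᶠ-squares : ∀ {g} → g Preserves _≈_ ⟶ _≡_ → ∑ᶠ (λ y → g (y ⊗ y)) ≡ ∑ᶠ (λ z → roots z * g z)
  ∑ᶠ-squares {g} g-cong = begin
    ∑ᶠ (λ y → g (y ⊗ y))
      ≡⟨ ∑ᶠ-cong (λ y → ∑ᶠ-δ g-cong (y ⊗ y)) ⟨
    ∑ᶠ (λ y → ∑ᶠ (λ z → ⟦ y ⊗ y ≈? z ⟧ * g z))
      ≡⟨ ∑-comm (λ i j → ⟦ elem i ⊗ elem i ≈? elem j ⟧ * g (elem j)) ⟩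
    ∑ᶠ (λ z → ∑ᶠ (λ y → ⟦ y ⊗ y ≈? z ⟧ * g z))
      ≡⟨ ∑ᶠ-cong (λ z → *-distribʳ-sum (g z) (λ i → ⟦ elem i ⊗ elem i ≈? z ⟧)) ⟨
    ∑ᶠ (λ z → roots z * g z) ∎
    where open ≡-Reasoning

  ∑ᶠ-const : ∀ x → ∑ᶠ (λ _ → x) ≡ q * x
  ∑ᶠ-const = sum-const q

  ∑ᶠ-+ : ∀ g h → ∑ᶠ (λ x → g x + h x) ≡ ∑ᶠ g + ∑ᶠ h
  ∑ᶠ-+ g h = ∑-distrib-+ (g ∘ elem) (h ∘ elem)

  ∑ᶠ-neg : ∀ {g} → g Preserves _≈_ ⟶ _≡_ → ∑ᶠ (λ x → g (⊖ x)) ≡ ∑ᶠ g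
  ∑ᶠ-neg g-cong = ∑ᶠ-reindex g-cong ⊖_ ⊖_ -‿cong -‿cong -‿involutive -‿involutive

  ∑ᶠ-roots : ∑ᶠ roots ≡ q
  ∑ᶠ-roots = begin
    ∑ᶠ roots                   ≡⟨ ∑ᶠ-cong (λ z → sym (ℕ.*-identityʳ (roots z))) ⟩
    ∑ᶠ (λ z → roots z * 1)     ≡⟨ ∑ᶠ-squares {λ _ → 1} (λ _ → refl) ⟨
    ∑ᶠ (λ _ → 1)               ≡⟨ trans (∑ᶠ-const 1) (ℕ.*-identityʳ q) ⟩
    q                          ∎
    where open ≡-Reasoning

  module _ (-1-nonsquare : ¬ IsSquare (⊖ 1#)) where

    -- A square and its negative are not both nonzero squares, so the sum is at most 2;
    -- on average it is exactly 2.
    roots-neg : ∀ z → roots z + roots (⊖ z) ≡ 2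
    roots-neg z = trans
      (cong₂ _+_ (roots-cong (≈-sym (elem-index z))) (roots-cong (-‿cong (≈-sym (elem-index z)))))
      (sum-mono-≡ (≤2 ∘ elem) total (index z))
      where
      total : ∑ᶠ (λ z → roots z + roots (⊖ z)) ≡ ∑ᶠ (λ _ → 2)
      total = trans (∑ᶠ-+ roots (roots ∘ ⊖_)) (trans
        (cong₂ _+_ ∑ᶠ-roots (trans (∑ᶠ-neg roots-cong) ∑ᶠ-roots))
        (trans (double q) (sym (∑ᶠ-const 2))))
        where
        double : ∀ x → x + x ≡ x * 2
        double = solve-∀
      -- If `w² = z` and `v² = -z`, then `v / w` is a square root of `-1`.
      neg-nonsquare : ∀ {z} → ¬ z ≈ 0# → IsSquare z → ¬ IsSquare (⊖ z)
      neg-nonsquare {z} z≉0 (w , w²≈z) (v , v²≈-z) = -1-nonsquare (v ⊗ w⁻¹ , (begin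
        v ⊗ w⁻¹ ⊗ (v ⊗ w⁻¹)         ≈⟨ solveᶠ 2 (λ v u → v :* u :* (v :* u) := v :* v :* (u :* u)) ≈-refl v w⁻¹ ⟩
        v ⊗ v ⊗ (w⁻¹ ⊗ w⁻¹)         ≈⟨ *-congʳ (≈-trans v²≈-z (-‿cong (≈-sym w²≈z))) ⟩
        ⊖ (w ⊗ w) ⊗ (w⁻¹ ⊗ w⁻¹)     ≈⟨ -‿distribˡ-* _ _ ⟨
        ⊖ (w ⊗ w ⊗ (w⁻¹ ⊗ w⁻¹))     ≈⟨ -‿cong (solveᶠ 2 (λ w u → w :* w :* (u :* u) := w :* u :* (w :* u)) ≈-refl w w⁻¹) ⟩
        ⊖ (w ⊗ w⁻¹ ⊗ (w ⊗ w⁻¹))     ≈⟨ -‿cong (≈-trans (*-cong ww⁻¹≈1 ww⁻¹≈1) (*-identityˡ 1#)) ⟩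
        ⊖ 1#                        ∎))
        where
        open ≈-Reasoning
        w≉0 : ¬ w ≈ 0#
        w≉0 w≈0 = z≉0 (≈-trans (≈-sym w²≈z) (≈-trans (*-congʳ w≈0) (zeroˡ w)))
        w⁻¹ = proj₁ (invert w≉0)
        ww⁻¹≈1 = proj₂ (invert w≉0)
      ≤2 : ∀ z → roots z + roots (⊖ z) ≤ 2
      ≤2 z with z ≈? 0# | isSquare? z
      ... | yes z≈0 | _      = ℕ.≤-reflexive (cong₂ _+_ (roots-0 z≈0) (roots-0 (≈-trans (-‿cong z≈0) -0#≈0#)))
      ... | no z≉0  | yes sq = ℕ.+-mono-≤ (roots-≤2 z) (ℕ.≤-reflexive (roots-nonsquare (neg-nonsquare z≉0 sq)))
      ... | no _    | no ¬sq = ℕ.+-mono-≤ (ℕ.≤-reflexive (roots-nonsquare ¬sq)) (roots-≤2 (⊖ z))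

    -- Each `z` is taken by `y²` and by `-y²` together `roots z + roots (-z) = 2` times.
    ∑ᶠ-±squares : ∀ {g} → g Preserves _≈_ ⟶ _≡_ →
                  ∑ᶠ (λ y → g (y ⊗ y)) + ∑ᶠ (λ y → g (⊖ (y ⊗ y))) ≡ 2 * ∑ᶠ g
    ∑ᶠ-±squares {g} g-cong = begin
      ∑ᶠ (λ y → g (y ⊗ y)) + ∑ᶠ (λ y → g (⊖ (y ⊗ y)))
        ≡⟨ cong₂ _+_ (∑ᶠ-squares g-cong) (∑ᶠ-squares (g-cong ∘ -‿cong)) ⟩
      ∑ᶠ (λ z → roots z * g z) + ∑ᶠ (λ z → roots z * g (⊖ z))
        ≡⟨ cong (∑ᶠ (λ z → roots z * g z) +_) (trans
             (∑ᶠ-cong λ z → cong (_* g (⊖ z)) (roots-cong (≈-sym (-‿involutive z))))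
             (∑ᶠ-neg (λ z≈z′ → cong₂ _*_ (roots-cong (-‿cong z≈z′)) (g-cong z≈z′)))) ⟩
      ∑ᶠ (λ z → roots z * g z) + ∑ᶠ (λ z → roots (⊖ z) * g z)
        ≡⟨ ∑ᶠ-+ (λ z → roots z * g z) (λ z → roots (⊖ z) * g z) ⟨
      ∑ᶠ (λ z → roots z * g z + roots (⊖ z) * g z)
        ≡⟨ ∑ᶠ-cong (λ z → trans (sym (ℕ.*-distribʳ-+ (g z) (roots z) (roots (⊖ z)))) (cong (_* g z) (roots-neg z))) ⟩
      ∑ᶠ (λ z → 2 * g z)
        ≡⟨ *-distribˡ-sum 2 (g ∘ elem) ⟨
      2 * ∑ᶠ g ∎
      where open ≡-Reasoning

  ∑ᶠ-double : ∀ {g} → g Preserves _≈_ ⟶ _≡_ → ∑ᶠ (λ x → g (x ⊕ x)) ≡ ∑ᶠ g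
  ∑ᶠ-double g-cong = trans (∑ᶠ-cong λ x → g-cong (≈-sym (≈-trans (distribʳ x 1# 1#)
    (+-cong (*-identityˡ x) (*-identityˡ x))))) (∑ᶠ-scale g-cong 2≉0)

  -- With x = u + y, x² − y² = u (u + 2y) is equidistributed in y for each u ≠ 0.
  ∑ᶠ-difference-of-squares : ∀ {g} → g Preserves _≈_ ⟶ _≡_ →
    ∑ᶠ (λ x → ∑ᶠ (λ y → g (x ⊗ x ⊝ y ⊗ y))) + ∑ᶠ g ≡ q * ∑ᶠ g + q * g 0#
  ∑ᶠ-difference-of-squares {g} g-cong = begin
    ∑ᶠ (λ x → ∑ᶠ (λ y → g (x ⊗ x ⊝ y ⊗ y))) + ∑ᶠ g
      ≡⟨ cong₂ _+_ (trans substituted (∑-comm (λ j i → g (elem i ⊗ (elem i ⊕ (elem j ⊕ elem j))))))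
           (sym (∑ᶠ-δ {λ _ → ∑ᶠ g} (λ _ → refl) 0#)) ⟩
    ∑ᶠ A + ∑ᶠ (λ u → ⟦ 0# ≈? u ⟧ * ∑ᶠ g)
      ≡⟨ ∑ᶠ-+ A (λ u → ⟦ 0# ≈? u ⟧ * ∑ᶠ g) ⟨
    ∑ᶠ (λ u → A u + ⟦ 0# ≈? u ⟧ * ∑ᶠ g)
      ≡⟨ ∑ᶠ-cong pointwise ⟩
    ∑ᶠ (λ u → ∑ᶠ g + ⟦ 0# ≈? u ⟧ * (q * g 0#))
      ≡⟨ ∑ᶠ-+ (λ _ → ∑ᶠ g) (λ u → ⟦ 0# ≈? u ⟧ * (q * g 0#)) ⟩
    ∑ᶠ (λ u → ∑ᶠ g) + ∑ᶠ (λ u → ⟦ 0# ≈? u ⟧ * (q * g 0#))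
      ≡⟨ cong₂ _+_ (∑ᶠ-const (∑ᶠ g)) (∑ᶠ-δ {λ _ → q * g 0#} (λ _ → refl) 0#) ⟩
    q * ∑ᶠ g + q * g 0# ∎
    where
    open ≡-Reasoning
    A : Carrier → ℕ
    A u = ∑ᶠ (λ y → g (u ⊗ (u ⊕ (y ⊕ y))))
    substituted : ∑ᶠ (λ x → ∑ᶠ (λ y → g (x ⊗ x ⊝ y ⊗ y))) ≡ ∑ᶠ (λ y → ∑ᶠ (λ u → g (u ⊗ (u ⊕ (y ⊕ y)))))
    substituted = trans (∑-comm (λ i j → g (elem i ⊗ elem i ⊝ elem j ⊗ elem j))) (∑ᶠ-cong λ y → trans
      (sym (∑ᶠ-translate {λ x → g (x ⊗ x ⊝ y ⊗ y)} (λ x≈x′ → g-cong (⊝-cong (*-cong x≈x′ x≈x′) ≈-refl)) y))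
      (sum-cong-≗ {q} λ i → g-cong (⊝-solve
        (solveᶠ 2 (λ u y → (u :+ y) :* (u :+ y) := u :* (u :+ (y :+ y)) :+ y :* y) ≈-refl (elem i) y))))
    -- The inner sum is `q * g 0` at `u = 0` and the full sum of `g` elsewhere. Correcting both
    -- sides by the indicator of `u = 0` avoids subtraction.
    pointwise : ∀ u → A u + ⟦ 0# ≈? u ⟧ * ∑ᶠ g ≡ ∑ᶠ g + ⟦ 0# ≈? u ⟧ * (q * g 0#)
    pointwise u with 0# ≈? u
    ... | yes 0≈u = trans (ℕ.+-comm (A u) _) (cong₂ _+_ (ℕ.*-identityˡ _) (trans
      (trans (sum-cong-≗ {q} λ i → g-cong (≈-trans (*-congʳ (≈-sym 0≈u)) (zeroˡ (u ⊕ (elem i ⊕ elem i))))) (∑ᶠ-const (g 0#)))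
      (sym (ℕ.*-identityˡ _))))
    ... | no  0≉u = cong (_+ 0) (begin
      ∑ᶠ (λ y → g (u ⊗ (u ⊕ (y ⊕ y))))  ≡⟨ ∑ᶠ-double {λ y → g (u ⊗ (u ⊕ y))} (λ y≈y′ → g-cong (*-congˡ (+-congˡ y≈y′))) ⟩
      ∑ᶠ (λ y → g (u ⊗ (u ⊕ y)))        ≡⟨ ∑ᶠ-cong (λ y → g-cong (*-congˡ (+-comm u y))) ⟩
      ∑ᶠ (λ y → g (u ⊗ (y ⊕ u)))        ≡⟨ ∑ᶠ-translate {λ y → g (u ⊗ y)} (g-cong ∘ *-congˡ) u ⟩
      ∑ᶠ (λ y → g (u ⊗ y))              ≡⟨ ∑ᶠ-scale g-cong (0≉u ∘ ≈-sym) ⟩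
      ∑ᶠ g                              ∎)

  -- With `i² = -1`, the substitution of `i y` for `y` turns the sum of squares into a difference.
  ∑ᶠ-sum-of-squares-square : IsSquare (⊖ 1#) → ∀ {g} → g Preserves _≈_ ⟶ _≡_ →
    ∑ᶠ (λ x → ∑ᶠ (λ y → g (x ⊗ x ⊕ y ⊗ y))) + ∑ᶠ g ≡ q * ∑ᶠ g + q * g 0#
  ∑ᶠ-sum-of-squares-square (i , i²≈-1) {g} g-cong = trans
    (cong (_+ ∑ᶠ g) (∑ᶠ-cong λ x → trans
      (sym (∑ᶠ-scale {λ y → g (x ⊗ x ⊕ y ⊗ y)} (λ y≈y′ → g-cong (+-congˡ (*-cong y≈y′ y≈y′))) i≉0))
      (∑ᶠ-cong λ y → g-cong (+-congˡ ([iy]²≈-y² y)))))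
    (∑ᶠ-difference-of-squares g-cong)
    where
    i≉0 : ¬ i ≈ 0#
    i≉0 i≈0 = 1≉0 (≈-trans (≈-sym (-‿involutive 1#)) (≈-trans
      (-‿cong (≈-trans (≈-sym i²≈-1) (≈-trans (*-congʳ i≈0) (zeroˡ i)))) -0#≈0#))
    [iy]²≈-y² : ∀ y → i ⊗ y ⊗ (i ⊗ y) ≈ ⊖ (y ⊗ y)
    [iy]²≈-y² y = ≈-trans (solveᶠ 2 (λ i y → i :* y :* (i :* y) := i :* i :* (y :* y)) ≈-refl i y)
      (≈-trans (*-congʳ i²≈-1) (≈-trans (≈-sym (-‿distribˡ-* 1# (y ⊗ y))) (-‿cong (*-identityˡ (y ⊗ y)))))

  -- By `∑ᶠ-±squares` the sums over `x² + y²` and `x² - y²` together are `2q` times the sum of `g`;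
  -- the known value of the second one is then removed.
  ∑ᶠ-sum-of-squares-nonsquare : ¬ IsSquare (⊖ 1#) → ∀ {g} → g Preserves _≈_ ⟶ _≡_ →
    ∑ᶠ (λ x → ∑ᶠ (λ y → g (x ⊗ x ⊕ y ⊗ y))) + q * g 0# ≡ q * ∑ᶠ g + ∑ᶠ g
  ∑ᶠ-sum-of-squares-nonsquare ¬sq {g} g-cong =
    cancel S₊ S₋ (∑ᶠ g) (q * g 0#) S₊+S₋ (∑ᶠ-difference-of-squares g-cong)
    where
    S₊ = ∑ᶠ (λ x → ∑ᶠ (λ y → g (x ⊗ x ⊕ y ⊗ y)))
    S₋ = ∑ᶠ (λ x → ∑ᶠ (λ y → g (x ⊗ x ⊝ y ⊗ y)))
    S₊+S₋ : S₊ + S₋ ≡ q * (2 * ∑ᶠ g)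
    S₊+S₋ = begin
      S₊ + S₋
        ≡⟨ ∑ᶠ-+ (λ x → ∑ᶠ (λ y → g (x ⊗ x ⊕ y ⊗ y))) (λ x → ∑ᶠ (λ y → g (x ⊗ x ⊝ y ⊗ y))) ⟨
      ∑ᶠ (λ x → ∑ᶠ (λ y → g (x ⊗ x ⊕ y ⊗ y)) + ∑ᶠ (λ y → g (x ⊗ x ⊝ y ⊗ y)))
        ≡⟨ ∑ᶠ-cong (λ x → ∑ᶠ-±squares ¬sq {λ z → g (x ⊗ x ⊕ z)} (g-cong ∘ +-congˡ)) ⟩
      ∑ᶠ (λ x → 2 * ∑ᶠ (λ z → g (x ⊗ x ⊕ z)))
        ≡⟨ ∑ᶠ-cong (λ x → cong (2 *_) (trans (∑ᶠ-cong λ z → g-cong (+-comm (x ⊗ x) z)) (∑ᶠ-translate g-cong (x ⊗ x)))) ⟩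
      ∑ᶠ (λ x → 2 * ∑ᶠ g)
        ≡⟨ ∑ᶠ-const (2 * ∑ᶠ g) ⟩
      q * (2 * ∑ᶠ g) ∎
      where open ≡-Reasoning
    cancel : ∀ s₊ s₋ G h → s₊ + s₋ ≡ q * (2 * G) → s₋ + G ≡ q * G + h → s₊ + h ≡ q * G + G
    cancel s₊ s₋ G h eq₁ eq₂ = ℕ.+-cancelˡ-≡ (q * G) _ _ (begin
      q * G + (s₊ + h)      ≡⟨ shuffle (q * G) s₊ h ⟩
      s₊ + (q * G + h)      ≡⟨ cong (s₊ +_) eq₂ ⟨
      s₊ + (s₋ + G)         ≡⟨ ℕ.+-assoc s₊ s₋ G ⟨
      s₊ + s₋ + G           ≡⟨ cong (_+ G) eq₁ ⟩
      q * (2 * G) + G       ≡⟨ split q G ⟩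
      q * G + (q * G + G)   ∎)
      where
      open ≡-Reasoning
      shuffle : ∀ a b c → a + (b + c) ≡ b + (a + c)
      shuffle = solve-∀
      split : ∀ q G → q * (2 * G) + G ≡ q * G + (q * G + G)
      split = solve-∀

  -- If `-1` were a square, the circle `x² + y² = 1` would have `q - 1` points. Grouping these
  -- points by `z = x²` and correcting for `z = 0` and `z = 1` shows that `4` divides `q + 3`, which
  -- is `2` modulo `4`.
  nonsquare⇐q%4≡3 : q ℕ.% 4 ≡ 3 → ¬ IsSquare (⊖ 1#)
  nonsquare⇐q%4≡3 q%4≡3 sq = ℕ.>⇒∤ {2} {4} (s≤s (s≤s (s≤s z≤n)))
    (ℕ.∣m+n∣m⇒∣n (subst (4 ∣_) q+3≡h+2 4∣q+3) (ℕ.n∣m*n (1 + q ℕ./ 4)))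
    where
    S : ℕ
    S = ∑ᶠ (λ x → ∑ᶠ (λ y → ⟦ 1# ≈? x ⊗ x ⊕ y ⊗ y ⟧))
    S+1≡q : S + 1 ≡ q
    S+1≡q = begin
      S + 1                          ≡⟨ cong (S +_) (∑ᶠ-point 1#) ⟨
      S + ∑ᶠ (λ z → ⟦ 1# ≈? z ⟧)     ≡⟨ ∑ᶠ-sum-of-squares-square sq {λ z → ⟦ 1# ≈? z ⟧} ⟦≈⟧-congˡ ⟩
      q * ∑ᶠ (λ z → ⟦ 1# ≈? z ⟧) + q * ⟦ 1# ≈? 0# ⟧
        ≡⟨ cong₂ (λ a b → q * a + q * b) (∑ᶠ-point 1#) (⟦⟧-false (1# ≈? 0#) 1≉0) ⟩
      q * 1 + q * 0                  ≡⟨ arithmetic q ⟩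
      q                              ∎
      where
      open ≡-Reasoning
      arithmetic : ∀ q → q * 1 + q * 0 ≡ q
      arithmetic = solve-∀
    S≡∑roots : S ≡ ∑ᶠ (λ z → roots z * roots (1# ⊝ z))
    S≡∑roots = trans
      (∑ᶠ-cong λ x → sum-cong-≗ {q} λ j → ⟦⟧-cong (1# ≈? x ⊗ x ⊕ elem j ⊗ elem j) (elem j ⊗ elem j ≈? 1# ⊝ x ⊗ x)
        (λ e → ≈-sym (⊝-solve (≈-trans e (+-comm _ _))))
        (λ e → ≈-trans (⊝-unsolve (≈-sym e)) (+-comm _ _)))
      (∑ᶠ-squares {λ z → roots (1# ⊝ z)} (λ z≈z′ → roots-cong (⊝-cong ≈-refl z≈z′)))
    -- Both root counts are even unless `z` is `0` or `1`. At these two values the product is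
    -- `1 * 2` or `2 * 1`, and the added `2` completes it to `4`. The corrections contribute `4` in
    -- all.
    T : Carrier → ℕ
    T z = roots z * roots (1# ⊝ z) + (⟦ 0# ≈? z ⟧ * 2 + ⟦ 1# ≈? z ⟧ * 2)
    4∣T : ∀ z → 4 ∣ T z
    4∣T z with 0# ≈? z | 1# ≈? z
    ... | yes 0≈z | yes 1≈z = contradiction (≈-trans 1≈z (≈-sym 0≈z)) 1≉0
    ... | yes 0≈z | no _    = subst (4 ∣_) (cong₂ (λ a b → a * b + 2) (sym (roots-0 (≈-sym 0≈z)))
      (sym (roots-square {1#} (≈-trans (*-identityˡ 1#) (≈-sym 1-z≈1)) (1≉0 ∘ ≈-trans (≈-sym 1-z≈1))))) ℕ.∣-refl
      where
      1-z≈1 : 1# ⊝ z ≈ 1#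
      1-z≈1 = ⊝-solve (≈-sym (≈-trans (+-congˡ (≈-sym 0≈z)) (+-identityʳ 1#)))
    ... | no _    | yes 1≈z = subst (4 ∣_) (cong₂ (λ a b → a * b + 2)
      (sym (roots-square {1#} (≈-trans (*-identityˡ 1#) 1≈z) (1≉0 ∘ ≈-trans 1≈z)))
      (sym (roots-0 (x≈y⇒x⊝y≈0 1≈z)))) ℕ.∣-refl
    ... | no 0≉z  | no 1≉z  = subst (4 ∣_) (sym (ℕ.+-identityʳ _))
      (ℕ.*-pres-∣ (roots-even (0≉z ∘ ≈-sym)) (roots-even (1≉z ∘ x⊝y≈0⇒x≈y)))
    ∑T≡q+3 : ∑ᶠ T ≡ q + 3
    ∑T≡q+3 = begin
      ∑ᶠ T
        ≡⟨ ∑ᶠ-+ (λ z → roots z * roots (1# ⊝ z)) (λ z → ⟦ 0# ≈? z ⟧ * 2 + ⟦ 1# ≈? z ⟧ * 2) ⟩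
      ∑ᶠ (λ z → roots z * roots (1# ⊝ z)) + ∑ᶠ (λ z → ⟦ 0# ≈? z ⟧ * 2 + ⟦ 1# ≈? z ⟧ * 2)
        ≡⟨ cong₂ _+_ (sym S≡∑roots) (trans (∑ᶠ-+ (λ z → ⟦ 0# ≈? z ⟧ * 2) (λ z → ⟦ 1# ≈? z ⟧ * 2))
             (cong₂ _+_ (∑ᶠ-δ {λ _ → 2} (λ _ → refl) 0#) (∑ᶠ-δ {λ _ → 2} (λ _ → refl) 1#))) ⟩
      S + 4                ≡⟨ ℕ.+-assoc S 1 3 ⟨
      S + 1 + 3            ≡⟨ cong (_+ 3) S+1≡q ⟩
      q + 3                ∎
      where open ≡-Reasoning
    4∣q+3 : 4 ∣ q + 3
    4∣q+3 = subst (4 ∣_) ∑T≡q+3 (sum-∣ {q} (4∣T ∘ elem))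
    q+3≡h+2 : q + 3 ≡ (1 + q ℕ./ 4) * 4 + 2
    q+3≡h+2 = trans (cong (_+ 3) (trans (ℕ.m≡m%n+[m/n]*n q 4) (cong (_+ q ℕ./ 4 * 4) q%4≡3))) (arithmetic (q ℕ./ 4))
      where
      arithmetic : ∀ h → 3 + h * 4 + 3 ≡ (1 + h) * 4 + 2
      arithmetic = solve-∀

  -- Points on quadrics

  quadric-unfold : ∀ n t → quadric (2 + n) t ≡ ∑ᶠ (λ x → ∑ᶠ (λ y → quadric n (t ⊝ (x ⊗ x ⊕ y ⊗ y))))
  quadric-unfold n t = trans (fibre-suc (suc n) (λ _ x → x ⊗ x) t) (∑ᶠ-cong λ x → trans
    (fibre-suc n (λ _ x → x ⊗ x) (t ⊝ x ⊗ x))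
    (sum-cong-≗ {q} λ j → fibre-cong n (λ _ x → x ⊗ x)
      (≈-sym (⊝-solve (≈-sym (t-x-y+x+y (x ⊗ x) (elem j ⊗ elem j)))))))
    where
    t-x-y+x+y : ∀ u v → t ⊝ u ⊝ v ⊕ (u ⊕ v) ≈ t
    t-x-y+x+y u v = ≈-trans (+-congˡ (+-comm u v)) (≈-trans (≈-sym (+-assoc _ v u))
      (≈-trans (+-congʳ (x⊝y⊕y≈x (t ⊝ u) v)) (x⊝y⊕y≈x t u)))

  module _ (n : ℕ) (t : Carrier) where

    private
      g : Carrier → ℕ
      g z = quadric n (t ⊝ z)
      g-cong : g Preserves _≈_ ⟶ _≡_
      g-cong z≈z′ = fibre-cong n (λ _ x → x ⊗ x) (⊝-cong ≈-refl z≈z′)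
      ∑g : ∑ᶠ g ≡ q ^ n
      ∑g = trans (∑ᶠ-reflect (fibre-cong n (λ _ x → x ⊗ x)) t) (∑ᶠ-fibre n (λ _ x → x ⊗ x))
      g0 : g 0# ≡ quadric n t
      g0 = fibre-cong n (λ _ x → x ⊗ x) (⊝-solve (≈-sym (+-identityʳ t)))

    -- Two coordinates are split off, and the two-square identity is applied to
    -- `g z = quadric n (t - z)`, whose total is `q ^ n` and whose value at `0` is `quadric n t`.
    quadric-step-square : IsSquare (⊖ 1#) → quadric (2 + n) t + q ^ n ≡ q * q ^ n + q * quadric n t
    quadric-step-square sq = begin
      quadric (2 + n) t + q ^ n      ≡⟨ cong₂ _+_ (quadric-unfold n t) (sym ∑g) ⟩
      _ + ∑ᶠ g                       ≡⟨ ∑ᶠ-sum-of-squares-square sq g-cong ⟩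
      q * ∑ᶠ g + q * g 0#            ≡⟨ cong₂ (λ a b → q * a + q * b) ∑g g0 ⟩
      q * q ^ n + q * quadric n t    ∎
      where open ≡-Reasoning

    quadric-step-nonsquare : ¬ IsSquare (⊖ 1#) → quadric (2 + n) t + q * quadric n t ≡ q * q ^ n + q ^ n
    quadric-step-nonsquare ¬sq = begin
      quadric (2 + n) t + q * quadric n t  ≡⟨ cong₂ _+_ (quadric-unfold n t) (cong (q *_) (sym g0)) ⟩
      _ + q * g 0#                         ≡⟨ ∑ᶠ-sum-of-squares-nonsquare ¬sq g-cong ⟩
      q * ∑ᶠ g + ∑ᶠ g                      ≡⟨ cong (λ a → q * a + a) ∑g ⟩
      q * q ^ n + q ^ n                    ∎
      where open ≡-Reasoning

  quadric-0-≤1 : ∀ t → quadric 0 t ≤ 1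
  quadric-0-≤1 t = ℕ.≤-trans (ℕ.≤-reflexive (ℕ.+-identityʳ _)) (⟦⟧-≤1 (0# ≈? t))

  quadric-1 : ∀ t → quadric 1 t ≡ roots t
  quadric-1 t = trans (fibre-suc 0 (λ _ x → x ⊗ x) t) (sum-cong-≗ {q} λ i → trans (ℕ.+-identityʳ _)
    (trans (sym (⟦⊕≈⟧ (elem i ⊗ elem i) 0# t)) (⟦≈⟧-congʳ (+-identityʳ (elem i ⊗ elem i)))))

  -- These say that `quadric n t` differs from the mean `q^(n-1)` by at most `q^(k-1)`, scaled by
  -- `q` so that the exponents remain natural. Both directions are kept because the induction on `n`
  -- may exchange them.
  UpperBound LowerBound : ℕ → ℕ → Set c
  UpperBound n k = ∀ t → q * quadric n t ≤ q ^ n + q ^ k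
  LowerBound n k = ∀ t → q ^ n ≤ q * quadric n t + q ^ k

  q>0 : 0 < q
  q>0 = ℕ.≤-trans (s≤s z≤n) (Fin.toℕ<n (index 0#))

  quadric-bounds-0 : UpperBound 0 1 × LowerBound 0 1
  quadric-bounds-0 =
    (λ t → ℕ.≤-trans (ℕ.*-monoʳ-≤ q (quadric-0-≤1 t)) (ℕ.m≤n+m (q * 1) 1)) ,
    (λ t → ℕ.≤-trans (ℕ.≤-trans q>0 (ℕ.≤-reflexive (sym (ℕ.*-identityʳ q)))) (ℕ.m≤n+m (q ^ 1) (q * quadric 0 t)))

  quadric-bounds-1 : UpperBound 1 1 × LowerBound 1 1
  quadric-bounds-1 =
    (λ t → ℕ.≤-trans (ℕ.*-monoʳ-≤ q (ℕ.≤-trans (ℕ.≤-reflexive (quadric-1 t)) (roots-≤2 t)))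
             (ℕ.≤-reflexive (ℕ.*-distribˡ-+ q 1 1))) ,
    (λ t → ℕ.m≤n+m (q ^ 1) (q * quadric 1 t))

  -- Here `c` and `C` stand for the counts at one level in dimensions `n` and `n + 2`, `A` for
  -- `q ^ n` and `B` for `q ^ k`.
  module _ {C c A B : ℕ} where

    private
      *-step : ∀ {x y} → x ≤ q * y + B → q * x ≤ q * (q * y) + q * B
      *-step {x} {y} x≤ = ℕ.≤-trans (ℕ.*-monoʳ-≤ q x≤) (ℕ.≤-reflexive (ℕ.*-distribˡ-+ q (q * y) B))

    upper-square : C + A ≡ q * A + q * c → q * c ≤ A + B → q * C ≤ q * (q * A) + q * B
    upper-square eq qc≤ = *-step (ℕ.+-cancelʳ-≤ A C _ (begin
      C + A            ≡⟨ eq ⟩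
      q * A + q * c    ≤⟨ ℕ.+-monoʳ-≤ (q * A) qc≤ ⟩
      q * A + (A + B)  ≡⟨ trans (cong (q * A +_) (ℕ.+-comm A B)) (sym (ℕ.+-assoc (q * A) B A)) ⟩
      q * A + B + A    ∎))
      where open ℕ.≤-Reasoning

    lower-square : C + A ≡ q * A + q * c → A ≤ q * c + B → q * (q * A) ≤ q * C + q * B
    lower-square eq A≤ = ℕ.≤-trans (ℕ.*-monoʳ-≤ q (ℕ.+-cancelʳ-≤ A (q * A) (C + B) (begin
      q * A + A            ≤⟨ ℕ.+-monoʳ-≤ (q * A) A≤ ⟩
      q * A + (q * c + B)  ≡⟨ ℕ.+-assoc (q * A) (q * c) B ⟨
      q * A + q * c + B    ≡⟨ cong (_+ B) eq ⟨
      C + A + B            ≡⟨ trans (ℕ.+-assoc C A B) (trans (cong (C +_) (ℕ.+-comm A B)) (sym (ℕ.+-assoc C B A))) ⟩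
      C + B + A            ∎))) (ℕ.≤-reflexive (ℕ.*-distribˡ-+ q C B))
      where open ℕ.≤-Reasoning

    upper-nonsquare : C + q * c ≡ q * A + A → A ≤ q * c + B → q * C ≤ q * (q * A) + q * B
    upper-nonsquare eq A≤ = *-step (ℕ.+-cancelʳ-≤ (q * c) C _ (begin
      C + q * c            ≡⟨ eq ⟩
      q * A + A            ≤⟨ ℕ.+-monoʳ-≤ (q * A) A≤ ⟩
      q * A + (q * c + B)  ≡⟨ trans (cong (q * A +_) (ℕ.+-comm (q * c) B)) (sym (ℕ.+-assoc (q * A) B (q * c))) ⟩
      q * A + B + q * c    ∎))
      where open ℕ.≤-Reasoning

    lower-nonsquare : C + q * c ≡ q * A + A → q * c ≤ A + B → q * (q * A) ≤ q * C + q * B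
    lower-nonsquare eq qc≤ = ℕ.≤-trans (ℕ.*-monoʳ-≤ q (ℕ.+-cancelʳ-≤ A (q * A) (C + B) (begin
      q * A + A        ≡⟨ eq ⟨
      C + q * c        ≤⟨ ℕ.+-monoʳ-≤ C qc≤ ⟩
      C + (A + B)      ≡⟨ trans (cong (C +_) (ℕ.+-comm A B)) (sym (ℕ.+-assoc C B A)) ⟩
      C + B + A        ∎))) (ℕ.≤-reflexive (ℕ.*-distribˡ-+ q C B))
      where open ℕ.≤-Reasoning

  -- Two further coordinates multiply the deviation from the mean by `q` if `-1` is a square and by
  -- `-q` otherwise. In the second case the upper bound comes from the lower one and conversely.
  quadric-bounds-step : ∀ {n k} → UpperBound n k × LowerBound n k →
                        UpperBound (2 + n) (suc k) × LowerBound (2 + n) (suc k)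
  quadric-bounds-step {n} {k} (upper , lower) with isSquare? (⊖ 1#)
  ... | yes sq = (λ t → upper-square (quadric-step-square n t sq) (upper t)) ,
                 (λ t → lower-square (quadric-step-square n t sq) (lower t))
  ... | no ¬sq = (λ t → upper-nonsquare (quadric-step-nonsquare n t ¬sq) (lower t)) ,
                 (λ t → lower-nonsquare (quadric-step-nonsquare n t ¬sq) (upper t))

  quadric-bounds-even : ∀ j → UpperBound (j * 2) (suc j) × LowerBound (j * 2) (suc j)
  quadric-bounds-even zero    = quadric-bounds-0
  quadric-bounds-even (suc j) = quadric-bounds-step {j * 2} {suc j} (quadric-bounds-even j)

  quadric-bounds-odd : ∀ j → UpperBound (suc (j * 2)) (suc j) × LowerBound (suc (j * 2)) (suc j)
  quadric-bounds-odd zero    = quadric-bounds-1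
  quadric-bounds-odd (suc j) = quadric-bounds-step {suc (j * 2)} {suc j} (quadric-bounds-odd j)

  module _ (-1-nonsquare : ¬ IsSquare (⊖ 1#)) where

    -- The recursion from dimension 0 gives `quadric 2 t + q * quadric 0 t = q + 1`. This is one
    -- power of `q` better than the general even case, but only from above: at `t = 0` the count is
    -- `1`.
    quadric-upper-2 : UpperBound 2 1
    quadric-upper-2 t = ℕ.≤-trans (ℕ.*-monoʳ-≤ q (ℕ.≤-trans (ℕ.m≤m+n (quadric 2 t) (q * quadric 0 t))
      (ℕ.≤-reflexive (quadric-step-nonsquare 0 t -1-nonsquare)))) (ℕ.≤-reflexive (ℕ.*-distribˡ-+ q (q * 1) 1))

    -- The deviation changes sign twice, so an upper bound alone, without its lower counterpart,
    -- propagates by four dimensions.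
    quadric-upper-step : ∀ {n k} → UpperBound n k → UpperBound (4 + n) (2 + k)
    quadric-upper-step {n} {k} upper t = upper-nonsquare {C = quadric (4 + n) t} {B = q * q ^ k}
      (quadric-step-nonsquare (2 + n) t -1-nonsquare)
      (lower-nonsquare (quadric-step-nonsquare n t -1-nonsquare) (upper t))

    quadric-upper-2mod4 : ∀ i → UpperBound (2 + i * 4) (1 + i * 2)
    quadric-upper-2mod4 zero    = quadric-upper-2
    quadric-upper-2mod4 (suc i) = quadric-upper-step {2 + i * 4} {1 + i * 2} (quadric-upper-2mod4 i)

  -- Hyperplane sections of the isotropic cone

  dot : ∀ {n} → Vector Carrier n → Vector Carrier n → Carrier
  dot a x = ∑K.sum (λ i → a i ⊗ x i)

  dot-cong : ∀ {n} {a b x y : Vector Carrier n} → (∀ i → a i ≈ b i) → (∀ i → x i ≈ y i) → dot a x ≈ dot b y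
  dot-cong a≋b x≋y = ∑K.sum-cong-≋ λ i → *-cong (a≋b i) (x≋y i)

  isotropic : ∀ {n} → Vector Carrier n → ℕ
  isotropic x = ⟦ dot x x ≈? 0# ⟧

  section : ∀ n → Vector Carrier n → Carrier → ℕ
  section n a t = ∑ᵛ n (λ x → isotropic x * ⟦ dot a x ≈? t ⟧)

  -- For `y ≠ 0` exactly one `s` solves the equation. For `y = 0` either all `q` values do or none,
  -- and the indicator on the left makes up the constant `1`.
  ∑ᶠ-pencil : ∀ y z t → ∑ᶠ (λ s → ⟦ s ⊗ y ⊕ z ≈? t ⟧) + ⟦ y ≈? 0# ⟧ ≡ 1 + q * (⟦ y ≈? 0# ⟧ * ⟦ z ≈? t ⟧)
  ∑ᶠ-pencil y z t with y ≈? 0#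
  ... | yes y≈0 = trans (ℕ.+-comm _ 1) (cong suc (trans
    (sum-cong-≗ {q} λ i → ⟦≈⟧-congʳ (≈-trans (+-congʳ (≈-trans (*-congˡ y≈0) (zeroʳ (elem i)))) (+-identityˡ z)))
    (trans (∑ᶠ-const ⟦ z ≈? t ⟧) (cong (q *_) (sym (ℕ.*-identityˡ _))))))
  ... | no y≉0 = trans (ℕ.+-identityʳ _) (trans (begin
    ∑ᶠ (λ s → ⟦ s ⊗ y ⊕ z ≈? t ⟧)   ≡⟨ sum-cong-≗ {q} (λ i → ⟦⟧-cong (elem i ⊗ y ⊕ z ≈? t) (t ≈? y ⊗ elem i ⊕ z)
                                         (λ e → ≈-sym (≈-trans (+-congʳ (*-comm y (elem i))) e))
                                         (λ e → ≈-sym (≈-trans e (+-congʳ (*-comm y (elem i)))))) ⟩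
    ∑ᶠ (λ s → ⟦ t ≈? y ⊗ s ⊕ z ⟧)   ≡⟨ ∑ᶠ-scale {λ s → ⟦ t ≈? s ⊕ z ⟧} (λ e → ⟦≈⟧-congˡ (+-congʳ e)) y≉0 ⟩
    ∑ᶠ (λ s → ⟦ t ≈? s ⊕ z ⟧)       ≡⟨ ∑ᶠ-translate {λ s → ⟦ t ≈? s ⟧} ⟦≈⟧-congˡ z ⟩
    ∑ᶠ (λ s → ⟦ t ≈? s ⟧)           ≡⟨ ∑ᶠ-point t ⟩
    1                               ∎) (cong suc (sym (ℕ.*-zeroʳ q))))
    where open ≡-Reasoning

  -- Count the pairs `(s, x)` with `s ‖x‖ + a·x = t` twice. By `∑ᶠ-pencil` their number plus
  -- `quadric n 0` is `q ^ n + q * section n a t`. For fixed `s`, the case `s = 0` is a linear form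
  -- and the others complete to a quadric, so `q` times each count is at most `q ^ n + q ^ k`.
  section-bound : ∀ {n k} → UpperBound n k → (a : Vector Carrier n) → ¬ (∀ i → a i ≈ 0#) →
                  ∀ t → q * section n a t ≤ quadric n 0# + q ^ k
  section-bound {n} {k} upper a a≉0 t = ℕ.+-cancelˡ-≤ (q ^ n) _ _ (begin
    q ^ n + q * section n a t           ≡⟨ pencil-total ⟨
    ∑ᶠ P + quadric n 0#                 ≤⟨ ℕ.+-monoˡ-≤ (quadric n 0#) ∑P≤ ⟩
    q ^ n + q ^ k + quadric n 0#        ≡⟨ trans (ℕ.+-assoc (q ^ n) (q ^ k) _) (cong (q ^ n +_) (ℕ.+-comm (q ^ k) _)) ⟩
    q ^ n + (quadric n 0# + q ^ k)      ∎)
    where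
    open ℕ.≤-Reasoning
    P : Carrier → ℕ
    P s = ∑ᵛ n (λ x → ⟦ s ⊗ dot x x ⊕ dot a x ≈? t ⟧)
    pencil-total : ∑ᶠ P + quadric n 0# ≡ q ^ n + q * section n a t
    pencil-total = begin-equality
      ∑ᶠ P + quadric n 0#
        ≡⟨ cong (_+ quadric n 0#) (∑-comm (λ i j → ⟦ elem i ⊗ dot (points n j) (points n j) ⊕ dot a (points n j) ≈? t ⟧)) ⟩
      ∑ᵛ n (λ x → ∑ᶠ (λ s → ⟦ s ⊗ dot x x ⊕ dot a x ≈? t ⟧)) + ∑ᵛ n isotropic
        ≡⟨ ∑-distrib-+ {q ^ n} _ _ ⟨
      ∑ᵛ n (λ x → ∑ᶠ (λ s → ⟦ s ⊗ dot x x ⊕ dot a x ≈? t ⟧) + isotropic x)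
        ≡⟨ sum-cong-≗ {q ^ n} (λ j → ∑ᶠ-pencil (dot (points n j) (points n j)) (dot a (points n j)) t) ⟩
      ∑ᵛ n (λ x → 1 + q * (isotropic x * ⟦ dot a x ≈? t ⟧))
        ≡⟨ ∑-distrib-+ {q ^ n} (λ _ → 1) _ ⟩
      ∑ᵛ n (λ _ → 1) + ∑ᵛ n (λ x → q * (isotropic x * ⟦ dot a x ≈? t ⟧))
        ≡⟨ cong₂ _+_ (trans (sum-const (q ^ n) 1) (ℕ.*-identityʳ _)) (sym (*-distribˡ-sum {q ^ n} q _)) ⟩
      q ^ n + q * section n a t ∎
    P≤ : ∀ s → q * P s ≤ q ^ n + q ^ k
    P≤ s with s ≈? 0#
    ... | yes s≈0 = ℕ.≤-trans (ℕ.≤-reflexive (trans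
      (cong (q *_) (sum-cong-≗ {q ^ n} λ j → ⟦≈⟧-congʳ (≈-trans (+-congʳ (≈-trans (*-congʳ s≈0) (zeroˡ _))) (+-identityˡ _))))
      (fibre-linear n a a≉0 t))) (ℕ.m≤m+n (q ^ n) (q ^ k))
    ... | no s≉0 = ℕ.≤-trans (ℕ.≤-reflexive (cong (q *_) (trans
      (sum-cong-≗ {q ^ n} λ j → ⟦≈⟧-congʳ (≈-sym (≈-trans
        (∑K.∑-distrib-+ (λ i → s ⊗ (points n j i ⊗ points n j i)) (λ i → a i ⊗ points n j i))
        (+-congʳ (≈-sym (∑K.*-distribˡ-sum s (λ i → points n j i ⊗ points n j i)))))))
      (proj₂ (completing-the-square s≉0 n a) t)))) (upper _)
    ∑P≤ : ∑ᶠ P ≤ q ^ n + q ^ k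
    ∑P≤ = ℕ.*-cancelˡ-≤ q {{>-nonZero q>0}} (begin
      q * ∑ᶠ P                    ≡⟨ *-distribˡ-sum q (P ∘ elem) ⟩
      ∑ᶠ (λ s → q * P s)          ≤⟨ sum-mono-≤ {q} (P≤ ∘ elem) ⟩
      ∑ᶠ (λ s → q ^ n + q ^ k)    ≡⟨ ∑ᶠ-const (q ^ n + q ^ k) ⟩
      q * (q ^ n + q ^ k)         ∎)

  -- Sums over vectors and over injective families of vectors.

  infix 4 _≋?_
  _≋?_ : ∀ {n} (x y : Vector Carrier n) → Dec (∀ i → x i ≈ y i)
  x ≋? y = Fin.all? (λ i → x i ≈? y i)

  Extensional : ∀ {n} → (Vector Carrier n → ℕ) → Set _
  Extensional g = ∀ {x y} → (∀ i → x i ≈ y i) → g x ≡ g y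

  ∑ᵛ-δ : ∀ {n g} → Extensional {n} g → ∀ x → ∑ᵛ n (λ y → ⟦ x ≋? y ⟧ * g y) ≡ g x
  ∑ᵛ-δ {zero}  {g} g-ext x = trans (ℕ.+-identityʳ _) (trans
    (cong (_* g Vector.[]) (⟦⟧-true (x ≋? Vector.[]) (λ ()))) (trans (ℕ.*-identityˡ _) (g-ext (λ ()))))
  ∑ᵛ-δ {suc n} {g} g-ext x = begin
    ∑ᵛ (suc n) (λ y → ⟦ x ≋? y ⟧ * g y)
      ≡⟨ ∑ᵛ-suc n (λ y → ⟦ x ≋? y ⟧ * g y) ⟩
    ∑ᶠ (λ a → ∑ᵛ n (λ y → ⟦ x ≋? a Vector.∷ y ⟧ * g (a Vector.∷ y)))
      ≡⟨ ∑ᶠ-cong (λ a → sum-cong-≗ {q ^ n} (λ j → trans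
           (cong (_* g (a Vector.∷ points n j)) (split a (points n j))) (ℕ.*-assoc ⟦ x zero ≈? a ⟧ _ _))) ⟩
    ∑ᶠ (λ a → ∑ᵛ n (λ y → ⟦ x zero ≈? a ⟧ * (⟦ x ∘ suc ≋? y ⟧ * g (a Vector.∷ y))))
      ≡⟨ ∑ᶠ-cong (λ a → *-distribˡ-sum ⟦ x zero ≈? a ⟧ (λ j → ⟦ x ∘ suc ≋? points n j ⟧ * g (a Vector.∷ points n j))) ⟨
    ∑ᶠ (λ a → ⟦ x zero ≈? a ⟧ * ∑ᵛ n (λ y → ⟦ x ∘ suc ≋? y ⟧ * g (a Vector.∷ y)))
      ≡⟨ ∑ᶠ-cong (λ a → cong (⟦ x zero ≈? a ⟧ *_) (∑ᵛ-δ {g = λ y → g (a Vector.∷ y)}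
           (λ y≋z → g-ext (λ { zero → ≈-refl ; (suc i) → y≋z i })) (x ∘ suc))) ⟩
    ∑ᶠ (λ a → ⟦ x zero ≈? a ⟧ * g (a Vector.∷ x ∘ suc))
      ≡⟨ ∑ᶠ-δ {λ a → g (a Vector.∷ x ∘ suc)} (λ a≈b → g-ext (λ { zero → a≈b ; (suc i) → ≈-refl })) (x zero) ⟩
    g (x zero Vector.∷ x ∘ suc)
      ≡⟨ g-ext (λ { zero → ≈-refl ; (suc i) → ≈-refl }) ⟩
    g x ∎
    where
    open ≡-Reasoning
    split : ∀ a y → ⟦ x ≋? a Vector.∷ y ⟧ ≡ ⟦ x zero ≈? a ⟧ * ⟦ x ∘ suc ≋? y ⟧
    split a y = ⟦⟧-× (x ≋? a Vector.∷ y) (x zero ≈? a) (x ∘ suc ≋? y)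
      (λ e → e zero , e ∘ suc) (λ (e₀ , e) → λ { zero → e₀ ; (suc i) → e i })

  -- Insert the indicator of `y = x i` and exchange the sums: by injectivity each `y` is counted at
  -- most once.
  ∑ᵛ-injection : ∀ {n p g} → Extensional {n} g → (x : Fin p → Vector Carrier n) →
                 (∀ {i j} → (∀ k → x i k ≈ x j k) → i ≡ j) → ∑[ i < p ] g (x i) ≤ ∑ᵛ n g
  ∑ᵛ-injection {n} {p} {g} g-ext x x-inj = begin
    ∑[ i < p ] g (x i)
      ≡⟨ sum-cong-≗ {p} (λ i → ∑ᵛ-δ g-ext (x i)) ⟨
    ∑[ i < p ] ∑ᵛ n (λ y → ⟦ x i ≋? y ⟧ * g y)
      ≡⟨ ∑-comm (λ i j → ⟦ x i ≋? points n j ⟧ * g (points n j)) ⟩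
    ∑ᵛ n (λ y → ∑[ i < p ] (⟦ x i ≋? y ⟧ * g y))
      ≡⟨ sum-cong-≗ {q ^ n} (λ j → *-distribʳ-sum {p} (g (points n j)) _) ⟨
    ∑ᵛ n (λ y → ∑[ i < p ] ⟦ x i ≋? y ⟧ * g y)
      ≤⟨ sum-mono-≤ {q ^ n} (λ j → ℕ.*-monoˡ-≤ (g (points n j)) (sum-⟦⟧-≤1 (λ i → x i ≋? points n j)
           (λ eᵢ eⱼ → x-inj (λ k → ≈-trans (eᵢ k) (≈-sym (eⱼ k)))))) ⟩
    ∑ᵛ n (λ y → 1 * g y)
      ≡⟨ sum-cong-≗ {q ^ n} (λ j → ℕ.*-identityˡ _) ⟩
    ∑ᵛ n g ∎
    where open ℕ.≤-Reasoning

  -- Collisions under a projection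

  module _ {m : ℕ} (φ : Fin m → Carrier) where

    multiplicity : Carrier → ℕ
    multiplicity t = ∑[ j < m ] ⟦ φ j ≈? t ⟧

    collisions : ℕ
    collisions = ∑[ i < m ] ∑[ j < m ] ⟦ φ i ≈? φ j ⟧

    ∑ᶠ-multiplicity : ∑ᶠ multiplicity ≡ m
    ∑ᶠ-multiplicity = trans (∑-comm (λ i j → ⟦ φ j ≈? elem i ⟧))
      (trans (sum-cong-≗ {m} (∑ᶠ-point ∘ φ)) (trans (sum-const m 1) (ℕ.*-identityʳ m)))

    ∑ᶠ-multiplicity² : ∑ᶠ (λ t → multiplicity t * multiplicity t) ≡ collisions
    ∑ᶠ-multiplicity² = begin
      ∑ᶠ (λ t → multiplicity t * multiplicity t)
        ≡⟨ ∑ᶠ-cong (λ t → sum-*-sum (λ i → ⟦ φ i ≈? t ⟧) (λ j → ⟦ φ j ≈? t ⟧)) ⟩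
      ∑ᶠ (λ t → ∑[ i < m ] ∑[ j < m ] (⟦ φ i ≈? t ⟧ * ⟦ φ j ≈? t ⟧))
        ≡⟨ ∑-comm (λ s i → ∑[ j < m ] (⟦ φ i ≈? elem s ⟧ * ⟦ φ j ≈? elem s ⟧)) ⟩
      ∑[ i < m ] ∑ᶠ (λ t → ∑[ j < m ] (⟦ φ i ≈? t ⟧ * ⟦ φ j ≈? t ⟧))
        ≡⟨ sum-cong-≗ {m} (λ i → ∑-comm (λ s j → ⟦ φ i ≈? elem s ⟧ * ⟦ φ j ≈? elem s ⟧)) ⟩
      ∑[ i < m ] ∑[ j < m ] ∑ᶠ (λ t → ⟦ φ i ≈? t ⟧ * ⟦ φ j ≈? t ⟧)
        ≡⟨ sum-cong-≗ {m} (λ i → sum-cong-≗ {m} (λ j → trans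
             (∑ᶠ-δ {λ t → ⟦ φ j ≈? t ⟧} ⟦≈⟧-congˡ (φ i)) (⟦⟧-cong (φ j ≈? φ i) (φ i ≈? φ j) ≈-sym ≈-sym))) ⟩
      collisions ∎
      where open ≡-Reasoning

    -- Cauchy-Schwarz over all `q` field values. This is what makes the excess of every cone vector
    -- nonnegative.
    m²≤q*collisions : m * m ≤ q * collisions
    m²≤q*collisions = begin
      m * m                            ≡⟨ cong₂ _*_ ∑ᶠ-multiplicity ∑ᶠ-multiplicity ⟨
      ∑ᶠ multiplicity * ∑ᶠ multiplicity ≤⟨ cauchy-schwarz (multiplicity ∘ elem) ⟩
      q * ∑ᶠ (λ t → multiplicity t * multiplicity t) ≡⟨ cong (q *_) ∑ᶠ-multiplicity² ⟩
      q * collisions                   ∎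
      where open ℕ.≤-Reasoning

    -- Cauchy-Schwarz over the `w` attained values only. One index is kept for each value, and these
    -- representatives later yield distinct cosets.
    distinct-values : ∃₂ λ w (j : Fin w → Fin m) →
      (∀ {a b} → φ (j a) ≈ φ (j b) → a ≡ b) × m * m ≤ w * collisions
    distinct-values with support (λ i → Fin.any? (λ j → φ j ≈? elem i))
    ... | w , ρ , value , ρ-inj , ∑ρ = w , proj₁ ∘ value , injective , (begin
      m * m
        ≡⟨ cong₂ _*_ ∑ᶠ-multiplicity ∑ᶠ-multiplicity ⟨
      ∑ᶠ multiplicity * ∑ᶠ multiplicity
        ≡⟨ cong₂ _*_ ∑a ∑a ⟩
      sum a * sum a
        ≤⟨ cauchy-schwarz a ⟩
      w * ∑[ i < w ] (a i * a i)
        ≡⟨ cong (w *_) (∑ρ (λ i → multiplicity (elem i) * multiplicity (elem i)) (λ i ¬v → cong (λ x → x * x) (off i ¬v))) ⟨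
      w * ∑ᶠ (λ t → multiplicity t * multiplicity t)
        ≡⟨ cong (w *_) ∑ᶠ-multiplicity² ⟩
      w * collisions ∎)
      where
      open ℕ.≤-Reasoning
      a : Vector ℕ w
      a = multiplicity ∘ elem ∘ ρ
      off : ∀ i → ¬ (∃ λ j → φ j ≈ elem i) → multiplicity (elem i) ≡ 0
      off i ¬v = sum-zero {m} λ j → ⟦⟧-false (φ j ≈? elem i) (λ e → ¬v (j , e))
      ∑a : ∑ᶠ multiplicity ≡ sum a
      ∑a = ∑ρ (multiplicity ∘ elem) off
      injective : ∀ {a b} → φ (proj₁ (value a)) ≈ φ (proj₁ (value b)) → a ≡ b
      injective {a} {b} e = ρ-inj (trans (sym (index-elem (ρ a))) (trans
        (index-cong (≈-trans (≈-sym (proj₂ (value a))) (≈-trans e (proj₂ (value b))))) (index-elem (ρ b))))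

  -- Energy of a point set along the isotropic cone.

  init-last-≋ : ∀ {n} {x y : Vector Carrier (suc n)} → (∀ i → Vector.init x i ≈ Vector.init y i) →
                Vector.last x ≈ Vector.last y → ∀ i → x i ≈ y i
  init-last-≋ {zero}  init≋ last≈ zero    = last≈
  init-last-≋ {suc n} init≋ last≈ zero    = init≋ zero
  init-last-≋ {suc n} init≋ last≈ (suc i) = init-last-≋ (init≋ ∘ suc) last≈ i

  module _ {n m : ℕ} (e : Fin m → Vector Carrier (suc n)) (e-inj : ∀ {i j} → (∀ k → e i k ≈ e j k) → i ≡ j)
           {l : Carrier} (l≉0 : ¬ l ≈ 0#) where

    -- The products of the points `e j` with the vector `(x, l)`.
    values : Vector Carrier n → Fin m → Carrier
    values x j = dot (Vector.init (e j)) x ⊕ Vector.last (e j) ⊗ l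

    incidences : Fin m → Fin m → ℕ
    incidences i j = ∑ᵛ n (λ x → isotropic x * ⟦ values x i ≈? values x j ⟧)

    -- On the diagonal every cone vector counts, and the extra `q ^ n` pays for this. Distinct
    -- points that agree in all but the last coordinate never collide, because `l` is nonzero. For
    -- any other pair the collisions form a section of the cone by an affine hyperplane, whose
    -- normal is the difference of the truncated points.
    incidences-bound : ∀ {k} → UpperBound n k → ∀ i j →
                       q * incidences i j ≤ quadric n 0# + q ^ k + ⟦ j Fin.≟ i ⟧ * q ^ n
    incidences-bound {k} upper i j with j Fin.≟ i
    ... | yes j≡i = begin
      q * incidences i j
        ≤⟨ ℕ.*-monoʳ-≤ q (sum-mono-≤ {q ^ n} λ h → ℕ.≤-trans
             (ℕ.*-monoʳ-≤ (isotropic (points n h)) (⟦⟧-≤1 (values (points n h) i ≈? values (points n h) j)))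
             (ℕ.≤-reflexive (ℕ.*-identityʳ _))) ⟩
      q * quadric n 0#                            ≤⟨ upper 0# ⟩
      q ^ n + q ^ k                               ≤⟨ ℕ.m≤n+m _ (quadric n 0#) ⟩
      quadric n 0# + (q ^ n + q ^ k)              ≡⟨ arithmetic (quadric n 0#) (q ^ n) (q ^ k) ⟩
      quadric n 0# + q ^ k + 1 * q ^ n            ∎
      where
      open ℕ.≤-Reasoning
      arithmetic : ∀ a b c → a + (b + c) ≡ a + c + 1 * b
      arithmetic = solve-∀
    ... | no j≢i with Fin.all? (λ h → Vector.init (e i) h ⊝ Vector.init (e j) h ≈? 0#)
    ...   | yes init≋ = ℕ.≤-trans (ℕ.≤-reflexive (trans (cong (q *_) (sum-zero {q ^ n} λ h → trans
      (cong (isotropic (points n h) *_)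
        (⟦⟧-false (values (points n h) i ≈? values (points n h) j) (distinct (points n h))))
      (ℕ.*-zeroʳ (isotropic (points n h))))) (ℕ.*-zeroʳ q))) z≤n
      where
      distinct : ∀ x → ¬ values x i ≈ values x j
      distinct x eq = j≢i (sym (e-inj (init-last-≋ {x = e i} {e j} (x⊝y≈0⇒x≈y ∘ init≋)
        (*-cancelˡ l≉0 (≈-trans (*-comm l _) (≈-trans (+-cancelˡ _ _ _ (≈-trans eq (+-congʳ (dot-cong {y = x} (≈-sym ∘ x⊝y≈0⇒x≈y ∘ init≋) (λ _ → ≈-refl)))))
          (*-comm _ l)))))))
    ...   | no ¬init≋ = begin
      q * incidences i j
        ≡⟨ cong (q *_) (sum-cong-≗ {q ^ n} λ h → cong (isotropic (points n h) *_)
             (⟦⟧-cong (values (points n h) i ≈? values (points n h) j) (dot a (points n h) ≈? t)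
               (to (points n h)) (from (points n h)))) ⟩
      q * section n a t           ≤⟨ section-bound {n} {k} upper a ¬init≋ t ⟩
      quadric n 0# + q ^ k        ≡⟨ ℕ.+-identityʳ _ ⟨
      quadric n 0# + q ^ k + 0    ∎
      where
      open ℕ.≤-Reasoning
      eᵢ = Vector.init (e i)
      eⱼ = Vector.init (e j)
      a : Vector Carrier n
      a h = eᵢ h ⊝ eⱼ h
      u = Vector.last (e i) ⊗ l
      v = Vector.last (e j) ⊗ l
      t = v ⊝ u
      dot-difference : ∀ x → dot eᵢ x ≈ dot a x ⊕ dot eⱼ x
      dot-difference x = ≈-sym (≈-trans (≈-sym (∑K.∑-distrib-+ (λ h → a h ⊗ x h) (λ h → eⱼ h ⊗ x h)))
        (∑K.sum-cong-≋ λ h → ≈-trans (≈-sym (distribʳ (x h) (a h) (eⱼ h))) (*-congʳ (x⊝y⊕y≈x (eᵢ h) (eⱼ h)))))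
      regroup : ∀ x → dot eⱼ x ⊕ (dot a x ⊕ u) ≈ values x i
      regroup x = ≈-trans (solveᶠ 3 (λ p q r → p :+ (q :+ r) := (q :+ p) :+ r) ≈-refl (dot eⱼ x) (dot a x) u)
        (+-congʳ (≈-sym (dot-difference x)))
      to : ∀ x → values x i ≈ values x j → dot a x ≈ t
      to x eq = ≈-sym (⊝-solve (≈-sym (+-cancelˡ (dot eⱼ x) _ _ (≈-trans (regroup x) eq))))
      from : ∀ x → dot a x ≈ t → values x i ≈ values x j
      from x eq = ≈-trans (≈-sym (regroup x)) (+-congˡ (≈-sym (⊝-unsolve (≈-sym eq))))

    energy : Vector Carrier n → ℕ
    energy x = collisions (values x)

    energy-ext : Extensional energy
    energy-ext x≋y = sum-cong-≗ {m} λ i → sum-cong-≗ {m} λ j →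
      trans (⟦≈⟧-congʳ (values-ext i)) (⟦≈⟧-congˡ (values-ext j))
      where
      values-ext : ∀ i → values _ i ≈ values _ i
      values-ext i = +-congʳ (dot-cong (λ _ → ≈-refl) x≋y)

    ∑ᵛ-energy : ∑ᵛ n (λ x → isotropic x * energy x) ≡ ∑[ i < m ] ∑[ j < m ] incidences i j
    ∑ᵛ-energy = begin
      ∑ᵛ n (λ x → isotropic x * energy x)
        ≡⟨ sum-cong-≗ {q ^ n} (λ h → trans
             (*-distribˡ-sum (isotropic (points n h)) (λ i → ∑[ j < m ] ⟦ values (points n h) i ≈? values (points n h) j ⟧))
             (sum-cong-≗ {m} λ i →
               *-distribˡ-sum (isotropic (points n h)) (λ j → ⟦ values (points n h) i ≈? values (points n h) j ⟧))) ⟩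
      ∑ᵛ n (λ x → ∑[ i < m ] ∑[ j < m ] (isotropic x * ⟦ values x i ≈? values x j ⟧))
        ≡⟨ ∑-comm (λ h i → ∑[ j < m ] (isotropic (points n h) * ⟦ values (points n h) i ≈? values (points n h) j ⟧)) ⟩
      ∑[ i < m ] ∑ᵛ n (λ x → ∑[ j < m ] (isotropic x * ⟦ values x i ≈? values x j ⟧))
        ≡⟨ sum-cong-≗ {m} (λ i → ∑-comm (λ h j → isotropic (points n h) * ⟦ values (points n h) i ≈? values (points n h) j ⟧)) ⟩
      ∑[ i < m ] ∑[ j < m ] incidences i j ∎
      where open ≡-Reasoning

    ∑ᵛ-energy-bound : ∀ {k} → UpperBound n k →
      q * ∑ᵛ n (λ x → isotropic x * energy x) ≤ m * (m * (quadric n 0# + q ^ k) + q ^ n)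
    ∑ᵛ-energy-bound {k} upper = begin
      q * ∑ᵛ n (λ x → isotropic x * energy x)
        ≡⟨ trans (cong (q *_) ∑ᵛ-energy) (trans (*-distribˡ-sum q (λ i → ∑[ j < m ] incidences i j))
             (sum-cong-≗ {m} λ i → *-distribˡ-sum q (incidences i))) ⟩
      ∑[ i < m ] ∑[ j < m ] (q * incidences i j)
        ≤⟨ sum-mono-≤ {m} (λ i → sum-mono-≤ {m} (incidences-bound {k} upper i)) ⟩
      ∑[ i < m ] ∑[ j < m ] (B + ⟦ j Fin.≟ i ⟧ * q ^ n)
        ≡⟨ sum-cong-≗ {m} (λ i → trans (∑-distrib-+ {m} (λ _ → B) (λ j → ⟦ j Fin.≟ i ⟧ * q ^ n))
             (cong₂ _+_ (sum-const m B) (sum-δ (λ _ → q ^ n) i))) ⟩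
      ∑[ i < m ] (m * B + q ^ n)
        ≡⟨ sum-const m (m * B + q ^ n) ⟩
      m * (m * B + q ^ n) ∎
      where
      open ℕ.≤-Reasoning
      B = quadric n 0# + q ^ k

    module _ {k p w : ℕ} (upper : UpperBound n k) (m>0 : 0 < m) (x : Fin p → Vector Carrier n)
             (x-inj : ∀ {i j} → (∀ h → x i h ≈ x j h) → i ≡ j) (x-isotropic : ∀ i → dot (x i) (x i) ≈ 0#) where

      private
        S = ∑[ i < p ] energy (x i)
        E = ∑ᵛ n (λ y → isotropic y * energy y)
        C = quadric n 0#

        -- The truncated subtraction is exact by `m²≤q*collisions`.
        excess : Vector Carrier n → ℕ
        excess y = q * energy y ∸ m * m

        ∑-excess : ∑[ i < p ] excess (x i) + p * (m * m) ≡ q * S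
        ∑-excess = trans (cong (∑[ i < p ] excess (x i) +_) (sym (sum-const p (m * m)))) (trans
          (sym (∑-distrib-+ (excess ∘ x) (λ _ → m * m))) (trans
          (sum-cong-≗ {p} λ i → ℕ.m∸n+n≡m (m²≤q*collisions (values (x i))))
          (sym (*-distribˡ-sum q (energy ∘ x)))))

        ∑ᵛ-excess : ∑ᵛ n (λ y → isotropic y * excess y) + C * (m * m) ≡ q * E
        ∑ᵛ-excess = trans (cong (∑ᵛ n (λ y → isotropic y * excess y) +_) (*-distribʳ-sum (m * m) (isotropic ∘ points n)))
          (trans (sym (∑-distrib-+ {q ^ n} (λ h → isotropic (points n h) * excess (points n h))
                                           (λ h → isotropic (points n h) * (m * m))))
          (trans (sum-cong-≗ {q ^ n} λ h → trans
            (sym (ℕ.*-distribˡ-+ (isotropic (points n h)) (excess (points n h)) (m * m)))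
            (trans (cong (isotropic (points n h) *_) (ℕ.m∸n+n≡m (m²≤q*collisions (values (points n h)))))
                   (exchange (isotropic (points n h)) q (energy (points n h)))))
          (sym (*-distribˡ-sum q (λ h → isotropic (points n h) * energy (points n h))))))
          where
          exchange : ∀ a b c → a * (b * c) ≡ b * (a * c)
          exchange = solve-∀

        ∑-excess≤ : ∑[ i < p ] excess (x i) ≤ ∑ᵛ n (λ y → isotropic y * excess y)
        ∑-excess≤ = ℕ.≤-trans
          (ℕ.≤-reflexive (sum-cong-≗ {p} λ i → sym (trans
            (cong (_* excess (x i)) (⟦⟧-true (dot (x i) (x i) ≈? 0#) (x-isotropic i))) (ℕ.*-identityˡ _))))
          (∑ᵛ-injection {g = λ y → isotropic y * excess y}
            (λ y≋z → cong₂ (λ a b → a * (q * b ∸ m * m)) (⟦≈⟧-congʳ (dot-cong y≋z y≋z)) (energy-ext y≋z)) x x-inj)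

        -- Nonnegative excess lets the sum over the family be replaced by the sum over the whole
        -- cone. There the term `C * (m * m)` from the subtracted squares cancels the `C` in the
        -- energy bound, so the size of the cone disappears.
        energy-upper : q * S ≤ m * (m * q ^ k + q ^ n) + p * (m * m)
        energy-upper = ℕ.+-cancelʳ-≤ (C * (m * m)) _ _ (begin
          q * S + C * (m * m)
            ≡⟨ cong (_+ C * (m * m)) ∑-excess ⟨
          ∑[ i < p ] excess (x i) + p * (m * m) + C * (m * m)
            ≤⟨ ℕ.+-monoˡ-≤ (C * (m * m)) (ℕ.+-monoˡ-≤ (p * (m * m)) ∑-excess≤) ⟩
          ∑ᵛ n (λ y → isotropic y * excess y) + p * (m * m) + C * (m * m)
            ≡⟨ swapʳ (∑ᵛ n (λ y → isotropic y * excess y)) (p * (m * m)) (C * (m * m)) ⟩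
          ∑ᵛ n (λ y → isotropic y * excess y) + C * (m * m) + p * (m * m)
            ≡⟨ cong (_+ p * (m * m)) ∑ᵛ-excess ⟩
          q * E + p * (m * m)
            ≤⟨ ℕ.+-monoˡ-≤ (p * (m * m)) (∑ᵛ-energy-bound {k} upper) ⟩
          m * (m * (C + q ^ k) + q ^ n) + p * (m * m)
            ≡⟨ arithmetic m C (q ^ k) (q ^ n) (p * (m * m)) ⟩
          m * (m * q ^ k + q ^ n) + p * (m * m) + C * (m * m) ∎)
          where
          open ℕ.≤-Reasoning
          swapʳ : ∀ a b c → a + b + c ≡ a + c + b
          swapʳ = solve-∀
          arithmetic : ∀ m C B A P → m * (m * (C + B) + A) + P ≡ m * (m * B + A) + P + C * (m * m)
          arithmetic = solve-∀

      -- Sum the hypothesis over the family, insert `energy-upper` and cancel one factor `m`. The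
      -- term `p * m` on the right is what later turns `q` into `q - N` in the denominators.
      few-directions : (∀ i → m * m ≤ w * energy (x i)) → q * p * m ≤ w * (p * m + m * q ^ k + q ^ n)
      few-directions m²≤ = ℕ.*-cancelˡ-≤ m {{>-nonZero m>0}} (begin
        m * (q * p * m)                                ≡⟨ arithmetic₁ m q p ⟩
        q * (p * (m * m))                              ≡⟨ cong (q *_) (sum-const p (m * m)) ⟨
        q * ∑[ i < p ] (m * m)                         ≤⟨ ℕ.*-monoʳ-≤ q (sum-mono-≤ {p} m²≤) ⟩
        q * ∑[ i < p ] (w * energy (x i))              ≡⟨ cong (q *_) (*-distribˡ-sum w (energy ∘ x)) ⟨
        q * (w * S)                                    ≡⟨ exchange q w S ⟩
        w * (q * S)                                    ≤⟨ ℕ.*-monoʳ-≤ w energy-upper ⟩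
        w * (m * (m * q ^ k + q ^ n) + p * (m * m))    ≡⟨ arithmetic₂ w m (q ^ k) (q ^ n) p ⟩
        m * (w * (p * m + m * q ^ k + q ^ n))          ∎)
        where
        open ℕ.≤-Reasoning
        exchange : ∀ a b c → a * (b * c) ≡ b * (a * c)
        exchange = solve-∀
        arithmetic₁ : ∀ m q p → m * (q * p * m) ≡ q * (p * (m * m))
        arithmetic₁ = solve-∀
        arithmetic₂ : ∀ w m B A p → w * (m * (m * B + A) + p * (m * m)) ≡ m * (w * (p * m + m * B + A))
        arithmetic₂ = solve-∀

-- Ordered fields

module OrderedFieldProperties {c ℓ₁ ℓ₂} (R : OrderedField c ℓ₁ ℓ₂) where

  open OrderedField R
    renaming (_+_ to infixl 6 _⊕_; _*_ to infixl 7 _⊗_; -_ to infix 8 ⊖_; _-_ to infixl 6 _⊝_; _≤_ to _≤ᴿ_; _<_ to infix 4 _<ᴿ_)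

  private
    module K = CommutativeRing (HeytingCommutativeRing.commutativeRing heytingCommutativeRing)
  open GroupProperties K.+-group using (//-rightDividesˡ)
  open RingProperties K.ring using (-0#≈0#)
  open Mult K.semiring using (×-homo-+; ×1-homo-*)
  open SemiringSolver K.commutativeSemiring using (_:+_; _:*_; _:=_) renaming (solve to solveᴿ)

  ι-+ : ∀ a b → ι (a + b) ≈ ι a ⊕ ι b
  ι-+ a b = ×-homo-+ 1# a b

  ι-* : ∀ a b → ι (a * b) ≈ ι a ⊗ ι b
  ι-* = ×1-homo-*

  x⊝y⊕y≈x : ∀ x y → x ⊝ y ⊕ y ≈ x
  x⊝y⊕y≈x x y = //-rightDividesˡ y x

  /-*-cancel : ∀ x {y} (0<y : 0# <ᴿ y) → (x / y [ 0<y ]) ⊗ y ≈ x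
  /-*-cancel x {y} 0<y with #⇒invertible (Equivalence.from #⇔<> (inj₂ 0<y))
  ... | i , i[y-0]≈1 , _ = K.trans (K.*-assoc x i y) (K.trans
    (K.*-congˡ (K.trans (K.*-congˡ (K.sym (K.trans (K.+-congˡ -0#≈0#) (K.+-identityʳ y)))) i[y-0]≈1)) (K.*-identityʳ x))

  *-monoʳ-< : ∀ {x y z} → 0# <ᴿ z → x <ᴿ y → x ⊗ z <ᴿ y ⊗ z
  *-monoʳ-< {x} {y} {z} 0<z x<y = <-respˡ-≈ (K.+-identityˡ (x ⊗ z)) (<-respʳ-≈
    (K.trans (K.sym (K.distribʳ z (y ⊝ x) x)) (K.*-congʳ (x⊝y⊕y≈x y x)))
    (+-monoʳ-< (x ⊗ z) (*-pos (x<y⇒0<y-x x<y) 0<z)))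

  -- An invertible element is apart from `0`, so it has a sign; a negative inverse multiplied by `x`
  -- would give `1 < 0`.
  1/x>0 : ∀ {x} (0<x : 0# <ᴿ x) → 0# <ᴿ 1# / x [ 0<x ]
  1/x>0 {x} 0<x = [ (λ i<0 → contradiction (<-trans 0<1 (1<0 i<0)) (<-irrefl K.refl)) , id ]′
    (Equivalence.to #⇔<> i#0)
    where
    i = 1# / x [ 0<x ]
    ix≈1 : i ⊗ x ≈ 1#
    ix≈1 = /-*-cancel 1# 0<x
    i-0≈i : i ⊝ 0# ≈ i
    i-0≈i = K.trans (K.+-congˡ -0#≈0#) (K.+-identityʳ i)
    i#0 : i # 0#
    i#0 = invertible⇒# (x , K.trans (K.*-congˡ i-0≈i) (K.trans (K.*-comm x i) ix≈1) , K.trans (K.*-congʳ i-0≈i) ix≈1)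
    1<0 : i <ᴿ 0# → 1# <ᴿ 0#
    1<0 i<0 = <-respˡ-≈ ix≈1 (<-respʳ-≈ (K.zeroˡ x) (*-monoʳ-< 0<x i<0))

  *-cancelʳ-< : ∀ {x y z} → 0# <ᴿ z → x ⊗ z <ᴿ y ⊗ z → x <ᴿ y
  *-cancelʳ-< {x} {y} {z} 0<z xz<yz = <-respˡ-≈ (unscale x) (<-respʳ-≈ (unscale y) (*-monoʳ-< (1/x>0 0<z) xz<yz))
    where
    unscale : ∀ x → x ⊗ z ⊗ (1# / z [ 0<z ]) ≈ x
    unscale x = K.trans (K.*-assoc x z _) (K.trans (K.*-congˡ (K.trans (K.*-comm z _) (/-*-cancel 1# 0<z))) (K.*-identityʳ x))

  <-ι-≤-trans : ∀ {x a b} → x <ᴿ ι a → a ≤ b → x <ᴿ ι b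
  <-ι-≤-trans {x} {a} {b} x<a a≤b with ℕ.m≤n⇒m<n∨m≡n a≤b
  ... | inj₂ refl = x<a
  ... | inj₁ a<b = <-trans x<a (<-respˡ-≈ (K.+-identityˡ (ι a))
    (<-respʳ-≈ (K.trans (K.sym (ι-+ (b ∸ a) a)) (K.reflexive (cong ι (ℕ.m∸n+n≡m a≤b))))
      (+-monoʳ-< (ι a) (0<ι (ℕ.m<n⇒0<n∸m a<b)))))

  -- Since `≤` is the negation of the reversed strict order, assume that the bound is less than `p`.
  -- Multiplying by `(q - N) m` and adding `p m N` gives `N T < q p m ≤ w T`, and cancelling the
  -- positive `T` contradicts `w ≤ N`.
  ≤-Bound : ∀ q n m k p w N (N<q : N <ᴿ ι q) (0<m : 0 < m) → ι w ≤ᴿ N → 0 < q ^ n →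
            q * p * m ≤ w * (p * m + m * q ^ k + q ^ n) → ι p ≤ᴿ Bound R q (suc n) m k N N<q 0<m
  ≤-Bound q n m k p w N N<q 0<m w≤N 0<qⁿ qpm≤ Bound<p = w≤N (*-cancelʳ-< 0<T (<-respʳ-≈ (ι-* w T)
    (<-ι-≤-trans NT<qpm qpm≤)))
    where
    T = p * m + m * q ^ k + q ^ n
    0<T : 0# <ᴿ ι T
    0<T = 0<ι (ℕ.≤-trans 0<qⁿ (ℕ.m≤n+m (q ^ n) (p * m + m * q ^ k)))
    D = ι q ⊝ N
    0<D = x<y⇒0<y-x N<q
    0<Dm = *-pos 0<D (0<ι 0<m)
    X = (N ⊗ ι (q ^ n)) / D ⊗ ι m [ 0<Dm ]
    Y = (N ⊗ ι (q ^ k)) / D [ 0<D ]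
    cleared : (X ⊕ Y) ⊗ (D ⊗ ι m) ⊕ ι p ⊗ ι m ⊗ N ≈ N ⊗ ι T
    cleared = begin
      (X ⊕ Y) ⊗ (D ⊗ ι m) ⊕ ι p ⊗ ι m ⊗ N
        ≈⟨ solveᴿ 6 (λ X Y D m p N → (X :+ Y) :* (D :* m) :+ p :* m :* N := X :* (D :* m) :+ Y :* D :* m :+ p :* m :* N)
             K.refl X Y D (ι m) (ι p) N ⟩
      X ⊗ (D ⊗ ι m) ⊕ Y ⊗ D ⊗ ι m ⊕ ι p ⊗ ι m ⊗ N
        ≈⟨ K.+-congʳ (K.+-cong (/-*-cancel _ 0<Dm) (K.*-congʳ (/-*-cancel _ 0<D))) ⟩
      N ⊗ ι (q ^ n) ⊕ N ⊗ ι (q ^ k) ⊗ ι m ⊕ ι p ⊗ ι m ⊗ N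
        ≈⟨ solveᴿ 5 (λ N A B m p → N :* A :+ N :* B :* m :+ p :* m :* N := N :* (p :* m :+ m :* B :+ A))
             K.refl N (ι (q ^ n)) (ι (q ^ k)) (ι m) (ι p) ⟩
      N ⊗ (ι p ⊗ ι m ⊕ ι m ⊗ ι (q ^ k) ⊕ ι (q ^ n))
        ≈⟨ K.*-congˡ (K.trans (ι-+ (p * m + m * q ^ k) (q ^ n)) (K.+-congʳ (K.trans (ι-+ (p * m) (m * q ^ k))
             (K.+-cong (ι-* p m) (ι-* m (q ^ k)))))) ⟨
      N ⊗ ι T ∎
      where open SetoidReasoning K.setoid
    whole : ι p ⊗ (D ⊗ ι m) ⊕ ι p ⊗ ι m ⊗ N ≈ ι (q * p * m)
    whole = begin
      ι p ⊗ (D ⊗ ι m) ⊕ ι p ⊗ ι m ⊗ N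
        ≈⟨ solveᴿ 4 (λ p D m N → p :* (D :* m) :+ p :* m :* N := (D :+ N) :* p :* m) K.refl (ι p) D (ι m) N ⟩
      (D ⊕ N) ⊗ ι p ⊗ ι m        ≈⟨ K.*-congʳ (K.*-congʳ (x⊝y⊕y≈x (ι q) N)) ⟩
      ι q ⊗ ι p ⊗ ι m            ≈⟨ K.trans (ι-* (q * p) m) (K.*-congʳ (ι-* q p)) ⟨
      ι (q * p * m)              ∎
      where open SetoidReasoning K.setoid
    NT<qpm : N ⊗ ι T <ᴿ ι (q * p * m)
    NT<qpm = <-respˡ-≈ cleared (<-respʳ-≈ whole (+-monoʳ-< (ι p ⊗ ι m ⊗ N) (*-monoʳ-< 0<Dm Bound<p)))

-- Lines through the origin

module Lines {c ℓ₁ ℓ₂} (F : HeytingField c ℓ₁ ℓ₂) (q : ℕ) (q-odd : ¬ (2 ∣ q))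
             (size : HasSize (HeytingField.setoid F) q) (n : ℕ) where

  open FiniteField F q q-odd size
  open Geometry F (suc n)
  open CommutativeRing K
    using (Carrier; _≈_; 0#; 1#; +-comm; +-congˡ; +-identityʳ; *-comm; *-cong; *-congˡ; *-congʳ; *-assoc;
           *-identityˡ; zeroˡ; distribʳ)
    renaming (_+_ to infixl 6 _⊕_; _*_ to infixl 7 _⊗_; -_ to infix 8 ⊖_;
              refl to ≈-refl; sym to ≈-sym; trans to ≈-trans; reflexive to ≈-reflexive)
  open RingProperties (CommutativeRing.ring K) using (+-cancelˡ)

  -- Relative to the given generator `u`, `v = s u` with `s` nonzero, so `t u = (t / s) v`.
  rescale : ∀ {v V} → IsLine V → v ∈ V → ¬ (∀ i → v i ≈ 0#) → ∀ {y} → y ∈ V → y ∈ Span v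
  rescale (u , _ , V⊆ , _) v∈V v≉0 y∈V with V⊆ v∈V | V⊆ y∈V
  ... | s , v≋su | t , y≋tu = t ⊗ s⁻¹ , λ i → ≈-trans (y≋tu i) (≈-sym (≈-trans (*-congˡ (v≋su i))
      (≈-trans (*-assoc t s⁻¹ (s ⊗ u i)) (*-congˡ (≈-trans (≈-sym (*-assoc s⁻¹ s (u i)))
        (≈-trans (*-congʳ (≈-trans (*-comm s⁻¹ s) ss⁻¹≈1)) (*-identityˡ (u i))))))))
    where
    s≉0 : ¬ s ≈ 0#
    s≉0 s≈0 = v≉0 λ i → ≈-trans (v≋su i) (≈-trans (*-congʳ s≈0) (zeroˡ (u i)))
    s⁻¹ = proj₁ (invert s≉0)
    ss⁻¹≈1 = proj₂ (invert s≉0)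

  line-⊆ : ∀ {v v′ V V′} → IsLine V → IsLine V′ → v ∈ V → v′ ∈ V′ → ¬ (∀ i → v i ≈ 0#) →
           (∀ i → v i ≈ v′ i) → ∀ {y} → y ∈ V → y ∈ V′
  line-⊆ V-line (u , _ , V′⊆ , ⊆V′) v∈V v′∈V′ v≉0 v≋v′ y∈V
    with rescale V-line v∈V v≉0 y∈V | V′⊆ v′∈V′
  ... | t , y≋tv | s , v′≋su = ⊆V′ (t ⊗ s , λ i → ≈-trans (y≋tv i)
    (≈-trans (*-congˡ (≈-trans (v≋v′ i) (v′≋su i))) (≈-sym (*-assoc t s (u i)))))

  ∈-Coset : ∀ y V → y ∈ Coset y (V ^⊥)
  ∈-Coset y V = 0ᵥ , (λ z _ → ≈-trans (∑K.sum-cong-≋ (λ i → zeroˡ (z i))) (∑K.sum-replicate-zero (suc n))) ,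
                λ i → ≈-sym (+-identityʳ (y i))

  -- The product with `v` is constant on cosets of the orthogonal complement, so points with
  -- different products lie in different cosets.
  Coset-∙ : ∀ {y y′ v V} → v ∈ V → y ∈ Coset y′ (V ^⊥) → dot y v ≈ dot y′ v
  Coset-∙ {y} {y′} {v} v∈V (w , w⊥V , y≋y′+w) = ≈-trans
    (∑K.sum-cong-≋ λ i → ≈-trans (*-congʳ (y≋y′+w i)) (distribʳ (v i) (y′ i) (w i)))
    (≈-trans (∑K.∑-distrib-+ (λ i → y′ i ⊗ v i) (λ i → w i ⊗ v i))
      (≈-trans (+-congˡ (w⊥V v v∈V)) (+-identityʳ (dot y′ v))))

  module _ {e r s₁ s₂} (R : OrderedField r s₁ s₂) (E : Pred Point e) (nonempty : Satisfiable E) (m : ℕ)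
           (E-size : HasSize (SubsetSetoid PointSetoid E) m) {l : Carrier} (l-sign : (l ≈ 1#) ⊎ (l ≈ ⊖ 1#))
           (N : OrderedField.Carrier R) (0<N : OrderedField._<_ R (OrderedField.0# R) N)
           (N<q : OrderedField._<_ R N (OrderedField.ι R q)) where

    private
      module R = OrderedField R

      𝒯 : Setoid _ _
      𝒯 = SubsetSetoid PointSetSetoid (T₁ R (X l) E N)

    l²≈1 : l ⊗ l ≈ 1#
    l²≈1 = [ (λ l≈1 → ≈-trans (*-cong l≈1 l≈1) (*-identityˡ 1#)) ,
             (λ l≈-1 → ≈-trans (*-cong l≈-1 l≈-1) (≈-trans ([⊖x]²≈x² 1#) (*-identityˡ 1#))) ]′ l-sign

    l≉0 : ¬ l ≈ 0#
    l≉0 l≈0 = 1≉0 (≈-trans (≈-sym l²≈1) (≈-trans (*-congʳ l≈0) (zeroˡ l)))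

    point : Fin m → Point
    point j = proj₁ (Inverse.to E-size j)

    point-injective : ∀ {i j} → (∀ k → point i k ≈ point j k) → i ≡ j
    point-injective {i} {j} eq = trans (sym (Inverse.strictlyInverseʳ E-size i))
      (trans (Inverse.from-cong E-size eq) (Inverse.strictlyInverseʳ E-size j))

    last-≈ : ∀ {v} → v ∈ Hyperplane l → Vector.last v ≈ l
    last-≈ {v} (i , suc-i≡d , vᵢ≈l) = ≈-trans (≈-reflexive (cong v (Fin.toℕ-injective
      (trans (Fin.toℕ-fromℕ n) (sym (ℕ.suc-injective suc-i≡d)))))) vᵢ≈l

    dot-init-last : ∀ y {v} → v ∈ Hyperplane l →
                    dot y v ≈ dot (Vector.init y) (Vector.init v) ⊕ Vector.last y ⊗ l
    dot-init-last y {v} v∈H = ≈-trans (∑K.sum-init-last (λ i → y i ⊗ v i)) (+-congˡ (*-congˡ (last-≈ v∈H)))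

    -- The last coordinate contributes `l² = 1` to `‖v‖ = 1`, so the other coordinates contribute
    -- `0`. This is where `l = ±1` enters.
    init-isotropic : ∀ {v} → v ∈ Hyperplane l → v ∈ Sphere → dot (Vector.init v) (Vector.init v) ≈ 0#
    init-isotropic {v} v∈H v∈S = +-cancelˡ 1# _ _ (≈-trans (+-comm 1# _) (≈-trans
      (+-congˡ (≈-sym (≈-trans (*-congʳ (last-≈ v∈H)) l²≈1)))
      (≈-trans (≈-sym (dot-init-last v v∈H)) (≈-trans v∈S (≈-sym (+-identityʳ 1#))))))

    -- A family of `p` distinct lines gives `p` distinct isotropic vectors, to which
    -- `few-directions` applies with a common bound `w ≤ N` on the numbers of attained values.
    directions-bound : ∀ {k} → UpperBound n k → R.AtMost 𝒯 (Bound R q (suc n) m k N N<q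
                         (size-positive {S = PointSetoid} {P = E} E-size nonempty))
    directions-bound {k} upper p lines = ≤-Bound q n m k p w N N<q m>0 w≤N (ℕ.m^n>0 q {{>-nonZero q>0}} n)
      (few-directions point point-injective l≉0 {k} {p} {w} upper m>0 x x-injective
        (λ i → init-isotropic (v∈H i) (v∈S i))
        (λ i → ℕ.≤-trans (m²≤ i) (ℕ.*-monoˡ-≤ (energy point point-injective l≉0 (x i)) (wᵢ≤w i))))
      where
      open OrderedFieldProperties R using (≤-Bound)
      m>0 = size-positive {S = PointSetoid} {P = E} E-size nonempty
      V : Fin p → PointSet
      V i = proj₁ (Injection.to lines i)
      V∈T₁ : ∀ i → V i ∈ T₁ R (X l) E N
      V∈T₁ i = proj₂ (Injection.to lines i)
      V-line : ∀ i → IsLine (V i)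
      V-line i = proj₁ (proj₁ (V∈T₁ i))
      v : Fin p → Point
      v i = proj₁ (proj₂ (proj₁ (V∈T₁ i)))
      v≉0 : ∀ i → ¬ (∀ h → v i h ≈ 0#)
      v≉0 i = proj₁ (proj₂ (proj₂ (proj₁ (V∈T₁ i))))
      v∈V : ∀ i → v i ∈ V i
      v∈V i = proj₁ (proj₂ (proj₂ (proj₂ (proj₁ (V∈T₁ i)))))
      v∈H : ∀ i → v i ∈ Hyperplane l
      v∈H i = proj₁ (proj₂ (proj₂ (proj₂ (proj₂ (proj₁ (V∈T₁ i))))))
      v∈S : ∀ i → v i ∈ Sphere
      v∈S i = proj₂ (proj₂ (proj₂ (proj₂ (proj₂ (proj₁ (V∈T₁ i))))))
      x : Fin p → Vector Carrier n
      x i = Vector.init (v i)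
      -- All `v i` end in the coordinate `l`, so `x i` determines `v i`, and a nonzero vector
      -- determines its line.
      x-injective : ∀ {i j} → (∀ h → x i h ≈ x j h) → i ≡ j
      x-injective {i} {j} xᵢ≋xⱼ = Injection.injective lines
        ( line-⊆ (V-line i) (V-line j) (v∈V i) (v∈V j) (v≉0 i) vᵢ≋vⱼ
        , line-⊆ (V-line j) (V-line i) (v∈V j) (v∈V i) (v≉0 j) (≈-sym ∘ vᵢ≋vⱼ))
        where
        vᵢ≋vⱼ : ∀ h → v i h ≈ v j h
        vᵢ≋vⱼ = init-last-≋ {x = v i} {v j} xᵢ≋xⱼ (≈-trans (last-≈ (v∈H i)) (≈-sym (last-≈ (v∈H j))))
      φ : Fin p → Fin m → Carrier
      φ i = values point point-injective l≉0 (x i)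
      φ≈dot : ∀ i j → dot (point j) (v i) ≈ φ i j
      φ≈dot i j = dot-init-last (point j) (v∈H i)
      W : Fin p → ℕ
      W i = proj₁ (distinct-values (φ i))
      m²≤ : ∀ i → m * m ≤ W i * energy point point-injective l≉0 (x i)
      m²≤ i = proj₂ (proj₂ (proj₂ (distinct-values (φ i))))
      -- Points with distinct products with `v i` give `W i` distinct cosets meeting `E`, and
      -- membership in `T₁` bounds the number of such cosets by `N`.
      W≤N : ∀ i → R.ι (W i) R.≤ N
      W≤N i = proj₂ (V∈T₁ i) (W i) (record { to = coset ; cong = λ { refl → id , id } ; injective = coset-injective })
        where
        j : Fin (W i) → Fin m
        j = proj₁ (proj₂ (distinct-values (φ i)))
        coset : Fin (W i) → ∃ (Projection (V i) E)
        coset a = Coset (point (j a)) (V i ^⊥) , point (j a) , (id , id) ,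
                  point (j a) , ∈-Coset (point (j a)) (V i) , proj₂ (Inverse.to E-size (j a))
        coset-injective : ∀ {a b} → Setoid._≈_ PointSetSetoid (proj₁ (coset a)) (proj₁ (coset b)) → a ≡ b
        coset-injective {a} {b} (a⊆b , _) = proj₁ (proj₂ (proj₂ (distinct-values (φ i))))
          (≈-trans (≈-sym (φ≈dot i (j a))) (≈-trans
            (Coset-∙ {point (j a)} {point (j b)} (v∈V i) (a⊆b (∈-Coset (point (j a)) (V i)))) (φ≈dot i (j b))))
      -- One `w` must serve all lines. The starting value 0 satisfies `0 ≤ N` because `N` is
      -- positive.
      bounded : ∃ λ w → (R.ι w R.≤ N) × (∀ i → W i ≤ w)
      bounded = upper-bound (λ w → R.ι w R.≤ N) (λ N<0 → R.<-irrefl R.refl (R.<-trans 0<N N<0)) W W≤N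
      w = proj₁ bounded
      w≤N = proj₁ (proj₂ bounded)
      wᵢ≤w = proj₂ (proj₂ bounded)

-- The quadric bound chosen for each residue of the dimension and of the field order.

theorem1p4 : ∀ {c ℓ₁ ℓ₂ e r s₁ s₂} (F : HeytingField c ℓ₁ ℓ₂) (R : OrderedField r s₁ s₂) →
    let module F = HeytingField F
        module R = OrderedField R
    in
    (q : ℕ) → IsOddPrimePower q →
    HasSize F.setoid q →
    (d : ℕ) → 3 ≤ d →
    let open Geometry F d in
    (E : Pred Point e) → E Respects (Setoid._≈_ PointSetoid) →
    (nonempty : Satisfiable E) →
    (m : ℕ) (size : HasSize (SubsetSetoid PointSetoid E) m) →
    (l : F.Carrier) → (l F.≈ F.1#) ⊎ (l F.≈ F.- F.1#) →
    (N : R.Carrier) → R.0# R.< N → (N<q : N R.< R.ι q) →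
    let 𝒯 = SubsetSetoid PointSetSetoid (T₁ R (X l) E N)
        bound = λ k → Bound R q d m k N N<q (size-positive {S = PointSetoid} {P = E} size nonempty)
        case₁ = 4 ≤ d × 2 ∣ d
        case₂ = d % 4 ≡ 3 × q % 4 ≡ 3
    in
    (case₁ → R.AtMost 𝒯 (bound (d / 2))) ×
    (case₂ → R.AtMost 𝒯 (bound ((d ∸ 1) / 2))) ×
    (¬ case₁ → ¬ case₂ → R.AtMost 𝒯 (bound ((d + 1) / 2)))
theorem1p4 F R q (q-odd , _) F-size (suc n) 3≤d E _ nonempty m E-size l l-sign N 0<N N<q =
    (λ (_ , 2∣d) → directions (suc n / 2) (case₁ 2∣d)) ,
    (λ (d%4≡3 , q%4≡3) → directions (n / 2) (case₂ d%4≡3 q%4≡3)) ,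
    (λ ¬case₁ _ → directions ((suc n + 1) / 2) (case₃ ¬case₁))
  where
  open FiniteField F q q-odd F-size
  directions : ∀ k → UpperBound n k → _
  directions k = Lines.directions-bound F q q-odd F-size n R E nonempty m E-size l-sign N 0<N N<q {k}
  -- Here `n = d - 1` is odd, say `2j + 1`, and the exponent `j + 1` is `d / 2`.
  case₁ : 2 ∣ suc n → UpperBound n (suc n / 2)
  case₁ (ℕ.divides (suc j) refl) =
    subst (UpperBound (suc (j * 2))) (sym (ℕ.m*n/n≡m (suc j) 2)) (proj₁ (quadric-bounds-odd j))
  -- Here `n = 2 + 4i` and `-1` is a nonsquare, so the improved exponent `1 + 2i = n / 2` is
  -- available.
  case₂ : suc n % 4 ≡ 3 → q % 4 ≡ 3 → UpperBound n (n / 2)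
  case₂ d%4≡3 q%4≡3 = subst (λ n → UpperBound n (n / 2)) (sym n≡2+4i)
    (subst (UpperBound (2 + i * 4)) (sym (trans (cong (_/ 2) (double i)) (ℕ.m*n/n≡m (1 + i * 2) 2)))
      (quadric-upper-2mod4 (nonsquare⇐q%4≡3 q%4≡3) i))
    where
    i = suc n / 4
    n≡2+4i : n ≡ 2 + i * 4
    n≡2+4i = ℕ.suc-injective (trans (ℕ.m≡m%n+[m/n]*n (suc n) 4) (cong (_+ i * 4) d%4≡3))
    double : ∀ i → 2 + i * 4 ≡ (1 + i * 2) * 2
    double = solve-∀
  case₃ : ¬ (4 ≤ suc n × 2 ∣ suc n) → UpperBound n ((suc n + 1) / 2)
  case₃ ¬case₁ with ℕ.m≤n⇒m<n∨m≡n 3≤d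
  -- For `d = 3` the cone lies in dimension `n = 2`, and the exponent is `2 = (3 + 1) / 2`. For
  -- `d ≥ 4` the failure of the first case forces `d` to be odd, so `n = 2j` with exponent `j + 1`.
  ... | inj₂ refl = proj₁ (quadric-bounds-even 1)
  ... | inj₁ 4≤d with suc n % 2 | ℕ.m%n<n (suc n) 2 | ℕ.m≡m%n+[m/n]*n (suc n) 2 | ℕ.m%n≡0⇒n∣m (suc n) 2
  ...   | zero        | _ | _  | 2∣d = contradiction (4≤d , 2∣d refl) ¬case₁
  ...   | suc zero    | _ | eq | _   = odd (suc n / 2) (ℕ.suc-injective eq)
    where
    odd : ∀ j → n ≡ j * 2 → UpperBound n ((suc n + 1) / 2)
    odd j refl = subst (UpperBound (j * 2)) (sym (trans (cong (_/ 2) (ℕ.+-comm (suc (j * 2)) 1)) (ℕ.m*n/n≡m (suc j) 2)))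
      (proj₁ (quadric-bounds-even j))
  ...   | suc (suc _) | s≤s (s≤s ()) | _ | _
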